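{- For every $n\ge 1$, the map $\rho:S_n\to \mathrm{dRec}_n$ restricts to a bijection between the twisted Baxter permutations in $S_n$ and the diagonal rectangulations of size $n$.
   Context: Permutations are written in one-line notation $x=x_1x_2\cdots x_n\in S_n$. $x$ contains the pattern 3-41-2 if $x_1\cdots x_n$ has a subsequence $c\,d\,a\,b$ with $a<b<c<d$ in which $d$ occurs immediately before $a$ in $x$; $x$ contains 2-41-3 if it has a subsequence $b\,d\,a\,c$ with $a<b<c<d$ in which $d$ occurs immediately before $a$ in $x$. Otherwise $x$ avoids the pattern. A twisted Baxter permutation is a permutation avoiding both 3-41-2 and 2-41-3. Diagonal rectangulations. Let $S$ be a square with sides parallel to the coordinate axes; its diagonal is the interior of the segment from its top-left corner to its bottom-right corner. For a subdivision of $S$ into finitely many (axis-parallel) rectangles, the walls are the maximal line segments contained in the union of the boundaries of the rectangles, excluding the four edges of $S$. For a set $X$ of $n-1$ distinct points on the diagonal, a diagonal rectangulation of $(S,X)$ is a subdivision of $S$ into rectangles such that no two walls intersect in their interiors, every wall contains a point of $X$, and every point of $X$ lies on exactly one wall. Diagonal rectangulations are considered up to dilation or translation of $S$ and order-preserving motion of the points of $X$ along the diagonal (carrying the walls along); an equivalence class is a diagonal rectangulation of size $n$, and it has a unique integral representative, with $S=[0,n]\times[0,n]$ and $X=\{(i,n-i):1\le i\le n-1\}$. $\mathrm{dRec}_n$ is the set of diagonal rectangulations of size $n$, identified with their integral representatives. The map $\rho:S_n\to\mathrm{dRec}_n$. Let $S=[0,n]\times[0,n]$, $p_i=(i,n-i)$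 for $0\le i\le n$, and give the space between $p_{k-1}$ and $p_k$ the label $k$. Read $x_1\cdots x_n$ from left to right, drawing one rectangle for each entry. Let $T_{i-1}$ be the union of the left and bottom edges of $S$ and the rectangles drawn in the first $i-1$ steps. In step $i$, put $k=x_i$, $p=p_{k-1}$, $p'=p_k$, and draw the rectangle with the following top-left and bottom-right corners. If $p\notin T_{i-1}$, the top-left corner is the rightmost point of $T_{i-1}$ directly left of $p$; if $p\in T_{i-1}$, it is the highest point of $T_{i-1}$ directly above (or equal to) $p$. If $p'\notin T_{i-1}$, the bottom-right corner is the highest point of $T_{i-1}$ directly below $p'$; if $p'\in T_{i-1}$, it is the rightmost point of $T_{i-1}$ directly right of (or equal to) $p'$. The $n$ rectangles drawn form the diagonal rectangulation $\rho(x)$. -}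

module Defs where

open import Data.Bool.Base using (if_then_else_)
open import Data.Fin.Base as Fin using (Fin; toℕ)
open import Data.Fin.Permutation as Perm using (Permutation′; _⟨$⟩ʳ_)
open import Data.List.Base using (List; []; _∷_; foldl; tabulate)
open import Data.List.Membership.Propositional using (_∈_; _∉_)
open import Data.List.Relation.Binary.BagAndSetEquality using (_∼[_]_; set)
open import Data.List.Relation.Unary.All using (All)
open import Data.List.Relation.Unary.Any using (Any; any?)
open import Data.Nat.Base using (ℕ; zero; suc; _∸_; _≤_; _<_)
open import Data.Nat.Properties using (_≟_; _≤?_)
open import Data.Product.Base using (Σ; _×_; _,_; ∃-syntax; proj₁)
open import Data.Product using (∃!)
open import Data.Sum.Base using (_⊎_)
open import Level using (0ℓ)
open import Relation.Binary.Core using (Rel)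
open import Relation.Binary.PropositionalEquality using (_≡_; _≢_)
open import Relation.Nullary using (¬_; Dec; does; _×-dec_; _⊎-dec_)
open import Relation.Unary using (Decidable)

-- A permutation x : Permutation′ n has one-line notation
-- x ⟨$⟩ʳ 0, x ⟨$⟩ʳ 1, …, with entries shifted down by one (0 … n-1).

-- The adjacent entries d, a of the pattern stand at positions j and k = j + 1.
Contains3-41-2 : ∀ {n} → Permutation′ n → Set
Contains3-41-2 {n} x =
  ∃[ i ] ∃[ j ] ∃[ k ] ∃[ l ]
    i Fin.< j × toℕ k ≡ suc (toℕ j) × k Fin.< l ×
    (let c = x ⟨$⟩ʳ i; d = x ⟨$⟩ʳ j; a = x ⟨$⟩ʳ k; b = x ⟨$⟩ʳ l in
     a Fin.< b × b Fin.< c × c Fin.< d)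

Contains2-41-3 : ∀ {n} → Permutation′ n → Set
Contains2-41-3 {n} x =
  ∃[ i ] ∃[ j ] ∃[ k ] ∃[ l ]
    i Fin.< j × toℕ k ≡ suc (toℕ j) × k Fin.< l ×
    (let b = x ⟨$⟩ʳ i; d = x ⟨$⟩ʳ j; a = x ⟨$⟩ʳ k; c = x ⟨$⟩ʳ l in
     a Fin.< b × b Fin.< c × c Fin.< d)

IsTwistedBaxter : ∀ {n} → Permutation′ n → Set
IsTwistedBaxter x = ¬ Contains3-41-2 x × ¬ Contains2-41-3 x

TwistedBaxter : ℕ → Set
TwistedBaxter n = Σ (Permutation′ n) IsTwistedBaxter

_≈ᵀ_ : ∀ {n} → Rel (TwistedBaxter n) 0ℓ
x ≈ᵀ y = proj₁ x Perm.≈ proj₁ y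

-- Diagonal rectangulations are given by their integral representatives, with
-- S = [0,n] × [0,n] and X = {(i , n - i) : 1 ≤ i ≤ n - 1}.  Every wall passes
-- through a point of X, so lies on a line with integer equation, and every
-- side of a rectangle lies in a wall or in an edge of S; hence all corners of
-- rectangles and all endpoints of walls have integer coordinates.  Point-set
-- conditions on such figures are therefore expressed through lattice points,
-- unit edges and unit cells.

Point : Set
Point = ℕ × ℕ

record Rect : Set where
  constructor rect
  field
    left bottom right top : ℕ

open Rect public

_∈ᴿ_ : Point → Rect → Set
(x , y) ∈ᴿ r = (left r ≤ x × x ≤ right r) × (bottom r ≤ y × y ≤ top r)

_∈ᴿ?_ : ∀ p r → Dec (p ∈ᴿ r)
(x , y) ∈ᴿ? r =
  ((left r ≤? x) ×-dec (x ≤? right r)) ×-dec ((bottom r ≤? y) ×-dec (y ≤? top r))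

-- The unit cell [i,i+1] × [j,j+1] is contained in r.
CellIn : ℕ → ℕ → Rect → Set
CellIn i j r = (left r ≤ i × i < right r) × (bottom r ≤ j × j < top r)

IsRectIn : ℕ → Rect → Set
IsRectIn n r = (left r < right r × right r ≤ n) × (bottom r < top r × top r ≤ n)

-- Existence of the rectangle containing a cell says that the rectangles cover
-- S, uniqueness that distinct rectangles have disjoint interiors.
IsSubdivision : ℕ → List Rect → Set
IsSubdivision n R =
  All (IsRectIn n) R ×
  (∀ i j → i < n → j < n → ∃! _≡_ λ r → r ∈ R × CellIn i j r)

-- hseg y a b = [a,b] × {y},  vseg x a b = {x} × [a,b]
data Segment : Set where
  hseg vseg : ℕ → ℕ → ℕ → Segment

Nondegenerate : Segment → Set
Nondegenerate (hseg y a b) = a < b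
Nondegenerate (vseg x a b) = a < b

_∈ˢ_ : Point → Segment → Set
(px , py) ∈ˢ hseg y a b = py ≡ y × a ≤ px × px ≤ b
(px , py) ∈ˢ vseg x a b = px ≡ x × a ≤ py × py ≤ b

InteriorPoint : Point → Segment → Set
InteriorPoint (px , py) (hseg y a b) = py ≡ y × a < px × px < b
InteriorPoint (px , py) (vseg x a b) = px ≡ x × a < py × py < b

_⊆ˢ_ : Segment → Segment → Set
s ⊆ˢ t = ∀ p → p ∈ˢ s → p ∈ˢ t

-- The unit edge [i,i+1] × {y} is contained in the boundary of r.
HEdgeOnBoundary : ℕ → ℕ → Rect → Set
HEdgeOnBoundary i y r = (left r ≤ i × i < right r) × (y ≡ bottom r ⊎ y ≡ top r)

-- The unit edge {x} × [j,j+1] is contained in the boundary of r.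
VEdgeOnBoundary : ℕ → ℕ → Rect → Set
VEdgeOnBoundary x j r = (bottom r ≤ j × j < top r) × (x ≡ left r ⊎ x ≡ right r)

-- The segment is contained in the union of the boundaries of the rectangles;
-- different unit edges of it may lie on different rectangles.
InBoundaries : List Rect → Segment → Set
InBoundaries R (hseg y a b) = ∀ i → a ≤ i → i < b → Any (HEdgeOnBoundary i y) R
InBoundaries R (vseg x a b) = ∀ j → a ≤ j → j < b → Any (VEdgeOnBoundary x j) R

edges : ℕ → List Segment
edges n = hseg 0 0 n ∷ hseg n 0 n ∷ vseg 0 0 n ∷ vseg n 0 n ∷ []

IsMaximalSegment : List Rect → Segment → Set
IsMaximalSegment R s =
  Nondegenerate s × InBoundaries R s ×
  (∀ t → Nondegenerate t → InBoundaries R t → s ⊆ˢ t → t ≡ s)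

IsWall : ℕ → List Rect → Segment → Set
IsWall n R s = IsMaximalSegment R s × s ∉ edges n

InX : ℕ → Point → Set
InX n p = ∃[ i ] 1 ≤ i × i < n × p ≡ (i , n ∸ i)

record IsDiagonalRectangulation (n : ℕ) (R : List Rect) : Set where
  field
    subdivision  : IsSubdivision n R
    noCrossing   : ∀ s t → IsWall n R s → IsWall n R t → s ≢ t →
                   ¬ (∃[ p ] InteriorPoint p s × InteriorPoint p t)
    wallHasPoint : ∀ s → IsWall n R s → ∃[ p ] InX n p × p ∈ˢ s
    pointOnWall  : ∀ p → InX n p → ∃! _≡_ λ s → IsWall n R s × p ∈ˢ s

dRec : ℕ → Set
dRec n = Σ (List Rect) (IsDiagonalRectangulation n)

-- The order and multiplicity of the rectangles in the list are irrelevant.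
_≈ᴰ_ : ∀ {n} → Rel (dRec n) 0ℓ
D ≈ᴰ E = proj₁ D ∼[ set ] proj₁ E

-- The greatest m ≤ b satisfying P, or 0 if there is none.
greatest : {P : ℕ → Set} → Decidable P → ℕ → ℕ
greatest P? zero    = zero
greatest P? (suc b) = if does (P? (suc b)) then suc b else greatest P? b

-- Membership of a point of S in the union T of the left and bottom edges of S
-- and the rectangles already drawn.
InT : List Rect → Point → Set
InT R (x , y) = (x ≡ 0 ⊎ y ≡ 0) ⊎ Any ((x , y) ∈ᴿ_) R

inT? : ∀ R → Decidable (InT R)
inT? R (x , y) = ((x ≟ 0) ⊎-dec (y ≟ 0)) ⊎-dec any? ((x , y) ∈ᴿ?_) R

-- The largest abscissa ≤ b of a point of T at height y, and the largest
-- ordinate ≤ b of a point of T with abscissa x.  They exist since T contains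
-- the left and bottom edges of S.
rightmost : List Rect → (y b : ℕ) → ℕ
rightmost R y b = greatest (λ x → inT? R (x , y)) b

highest : List Rect → (x b : ℕ) → ℕ
highest R x b = greatest (λ y → inT? R (x , y)) b

-- In the first case of topLeft the point p itself lies in T, so the highest
-- point of T on the vertical line through p is directly above or equal to p;
-- similarly for bottomRight.
topLeft bottomRight : ℕ → List Rect → Point → Point
topLeft n R p@(x , y) =
  if does (inT? R p) then (x , highest R x n) else (rightmost R y x , y)
bottomRight n R p@(x , y) =
  if does (inT? R p) then (rightmost R y n , y) else (x , highest R x y)

fromCorners : Point → Point → Rect
fromCorners (l , t) (r , b) = rect l b r t

-- An entry e : Fin n stands for the label k = toℕ e + 1, so that
-- p_{k-1} = (toℕ e , n - toℕ e).
draw : ∀ n → List Rect → Fin n → List Rect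
draw n R e = fromCorners (topLeft n R (diag (toℕ e)))
                         (bottomRight n R (diag (suc (toℕ e)))) ∷ R
  where
  diag : ℕ → Point
  diag i = i , n ∸ i

ρ : ∀ {n} → Permutation′ n → List Rect
ρ {n} x = foldl (draw n) [] (tabulate (x ⟨$⟩ʳ_))

{-# OPTIONS --safe #-}
-- In ρ(x) the unit cell in column i and row j (rows counted from the top)
-- belongs to the rectangle of the first of the labels i, …, j in x if i ≤ j,
-- and of the last of the labels j, …, i if j ≤ i.  Hence ρ(x) is a tiling in
-- which every tile contains a diagonal cell and no tile contains two.  Diagonal
-- rectangulations turn out to be exactly the tilings with this property, and
-- the permutations mapped to a given one are the linear extensions of a
-- relation ≺ between its tiles.  The linear extension that always takes the
-- smallest available label is twisted Baxter, which gives surjectivity.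
-- Conversely, two adjacent entries d a with a < d of a twisted Baxter
-- permutation satisfy d ≺ a, because all labels between a and d are on the same
-- side of them; so the permutation is the lexicographically smallest one in its
-- fibre, which gives injectivity.
module Submission where

open import Defs
open import Data.Bool.Base using (if_then_else_)
open import Data.Empty using (⊥)
open import Data.Fin.Base as Fin using (Fin; toℕ; fromℕ<; punchIn; punchOut)
import Data.Fin.Induction as Fin
import Data.Fin.Properties as Fin
open import Data.Fin.Permutation as Perm using (Permutation′; _⟨$⟩ʳ_; _⟨$⟩ˡ_; inverseˡ; inverseʳ; insert)
open import Data.List.Base using (List; []; _∷_; foldl; tabulate)
open import Data.List.Membership.Propositional using (_∈_; _∉_; find; lose)
open import Data.List.Properties using (tabulate-cong)
open import Data.List.Relation.Binary.BagAndSetEquality using (_∼[_]_; set; [_]-Equality)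
import Data.List.Relation.Unary.All as All
open import Data.List.Relation.Unary.Any using (Any; any?; here; there)
open import Data.Nat.Base using (ℕ; zero; suc; _+_; _∸_; _≤_; _<_; z≤n; s≤s; s≤s⁻¹; z<s)
open import Data.Nat.Properties
open import Data.Product using (∃!)
open import Data.Product.Base using (Σ-syntax; ∃; ∃-syntax; _×_; _,_; proj₁; proj₂; swap; map₂)
open import Data.Sum.Base as Sum using (_⊎_; inj₁; inj₂; [_,_]′)
open import Function.Base using (_∘_; flip; case_of_)
open import Function.Bundles using (mk⇔; Equivalence)
open import Function.Structures using (IsBijection)
open import Induction.WellFounded using (Acc; acc)
open import Level using (0ℓ)
open import Relation.Binary.Bundles using (Setoid)
import Relation.Binary.Construct.Flip.EqAndOrd as Flip
open import Relation.Binary.Core using (Rel)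
open import Relation.Binary.Definitions using (Tri; tri<; tri≈; tri>)
open import Relation.Binary.PropositionalEquality using (_≡_; _≢_; refl; sym; trans; cong; cong₂; subst; subst₂; isEquivalence)
open import Relation.Binary.Structures using (IsStrictTotalOrder)
open import Relation.Nullary using (¬_; Dec; yes; no; does; contradiction; _×-dec_; _⊎-dec_)
open import Relation.Nullary.Decidable using (decidable-stable; ¬?)
open import Relation.Unary using (Decidable)

-- Diagonal rectangulations are these tilings because every wall has to reach the diagonal. A
-- rectangle off the diagonal would have a corner whose two walls both run on past it towards the
-- diagonal, and so cross. Conversely, on a line through the diagonal point between the cells w and
-- w + 1, every unit edge lies in a side of tile w or w + 1 that passes this point, so its wall
-- passes it too. The relation ≺ holds only where a single side of one of the two tiles shows it; it
-- is not closed under transitivity. In this form i ≺ k also orders all labels between i and k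
-- against one and the same of the two. This replaces transitivity in the construction of a linear
-- extension, and both the pattern avoidance of the greedy extension and the lexicographic
-- minimality rest on it. Reflection in the diagonal exchanges rows with columns and corresponds to
-- reversing the permutation, which transfers many statements from one side of the diagonal to the
-- other.

-- Rows are numbered from the top, so that the diagonal cells are the cells
-- (k , k).  Tile k is [L k , R k) × [T k , B k) in (column , row) numbering,
-- and is named after a diagonal cell contained in it.
record Tiling (n : ℕ) : Set where
  field
    L R T B : ℕ → ℕ
    L≤ : ∀ {k} → k < n → L k ≤ k
    <R : ∀ {k} → k < n → k < R k
    R≤ : ∀ {k} → k < n → R k ≤ n
    T≤ : ∀ {k} → k < n → T k ≤ k
    <B : ∀ {k} → k < n → k < B k
    B≤ : ∀ {k} → k < n → B k ≤ n

  Covers : ℕ → ℕ → ℕ → Set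
  Covers k i j = (L k ≤ i × i < R k) × (T k ≤ j × j < B k)

  field
    cover    : ∀ {i j} → i < n → j < n → ∃[ k ] k < n × Covers k i j
    disjoint : ∀ {k m i j} → k < n → m < n → Covers k i j → Covers m i j → k ≡ m

  box : ℕ → Rect
  box k = rect (L k) (n ∸ B k) (R k) (n ∸ T k)

  VEdge : ℕ → ℕ → Set
  VEdge x j = ∃[ k ] k < n × (T k ≤ j × j < B k) × (x ≡ L k ⊎ x ≡ R k)

  covers-diagonal : ∀ {k} → k < n → Covers k k k
  covers-diagonal k<n = (L≤ k<n , <R k<n) , (T≤ k<n , <B k<n)

  -- Otherwise tile k contains the next diagonal cell below or above (k , k).
  covers-between : ∀ {i j k} → i ≤ j → j < n → k < n → Covers k i j → i ≤ k × k ≤ j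
  covers-between {i} {j} {k} i≤j j<n k<n ((L≤i , i<R) , (T≤j , j<B)) = ≮⇒≥ k≮i , ≮⇒≥ j≮k
    where
    k≮i : ¬ k < i
    k≮i k<i = <⇒≢ (n<1+n k) (disjoint k<n k+1<n
      ((m≤n⇒m≤1+n (L≤ k<n) , ≤-<-trans k<i i<R) ,
       (m≤n⇒m≤1+n (T≤ k<n) , ≤-<-trans (≤-trans k<i i≤j) j<B))
      (covers-diagonal k+1<n))
      where
      k+1<n : suc k < n
      k+1<n = ≤-<-trans (≤-trans k<i i≤j) j<n
    j≮k : ¬ j < k
    j≮k j<k = <⇒≢ j<k (disjoint (<-trans j<k k<n) k<n
      (covers-diagonal (<-trans j<k k<n))
      ((≤-trans L≤i i≤j , <-trans j<k (<R k<n)) , (T≤j , j<B)))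

transpose : ∀ {n} → Tiling n → Tiling n
transpose τ = record
  { L = T ; R = B ; T = L ; B = R
  ; L≤ = T≤ ; <R = <B ; R≤ = B≤ ; T≤ = L≤ ; <B = <R ; B≤ = R≤
  ; cover = λ i<n j<n → map₂ (map₂ swap) (cover j<n i<n)
  ; disjoint = λ k<n m<n c d → disjoint k<n m<n (swap c) (swap d)
  }
  where open Tiling τ

-- Unit edges of a tiling, and why they do not cross

module _ {n} (τ : Tiling n) where
  open Tiling τ
  private module τᵀ = Tiling (transpose τ)

  covers-between′ : ∀ {i j k} → j ≤ i → i < n → k < n → Covers k i j → j ≤ k × k ≤ i
  covers-between′ j≤i i<n k<n c = τᵀ.covers-between j≤i i<n k<n (swap c)

  -- The edge lies on the line x = w + 1 in row j, below the diagonal point between the cells w and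
  -- w + 1 in the first case, above it in the second. The tile found has its diagonal cell on the
  -- other side of that point, so its side passes the point.
  Classified : ℕ → ℕ → Set
  Classified w j = (suc w ≤ j × R w ≡ suc w × j < B w) ⊎
                   (j ≤ w × L (suc w) ≡ suc w × T (suc w) ≤ j)

  -- The tile to the left of an edge below the diagonal does not reach column
  -- w + 1, so its diagonal cell is (w , w).  Dually for the tile to the right
  -- of an edge above the diagonal.
  vedge-classify : ∀ {w j} → suc w < n → VEdge (suc w) j → Classified w j
  vedge-classify {w} {j} w+1<n (e , e<n , (Te≤j , j<Be) , side) = classify
    where
    w<n = <-trans (n<1+n w) w+1<n
    j<n = <-≤-trans j<Be (B≤ e<n)
    left-cell  = cover w<n j<n
    right-cell = cover w+1<n j<n
    k = proj₁ left-cell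
    m = proj₁ right-cell
    k<n = proj₁ (proj₂ left-cell)
    m<n = proj₁ (proj₂ right-cell)
    ck : Covers k w j
    ck = proj₂ (proj₂ left-cell)
    cm : Covers m (suc w) j
    cm = proj₂ (proj₂ right-cell)

    -- A tile with both cells would share one of them with tile e and hence be e, but the line x = w
    -- + 1 carries a side of e.
    not-both : ∀ {f} → f < n → Covers f w j → ¬ Covers f (suc w) j
    not-both {f} f<n c d = [ on-left , on-right ]′ side
      where
      Le<Re = ≤-<-trans (L≤ e<n) (<R e<n)
      rows  = Te≤j , j<Be
      on-left : suc w ≢ L e
      on-left eq = <⇒≱ (n<1+n w) (subst (_≤ w) (sym (trans eq (cong L e≡f))) (proj₁ (proj₁ c)))
        where
        e≡f : e ≡ f
        e≡f = disjoint e<n f<n ((≤-reflexive (sym eq) , subst (_< R e) (sym eq) Le<Re) , rows) d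
      on-right : suc w ≢ R e
      on-right eq = <-irrefl (trans eq (cong R e≡f)) (proj₂ (proj₁ d))
        where
        e≡f : e ≡ f
        e≡f = disjoint e<n f<n ((s≤s⁻¹ (subst (L e <_) (sym eq) Le<Re) , ≤-reflexive eq) , rows) c

    classify : Classified w j
    classify with suc w ≤? j
    ... | yes w<j = inj₁ (w<j , ≤-antisym R≤w+1 (<R w<n) , subst (λ v → j < B v) k≡w (proj₂ (proj₂ ck)))
      where
      w≤k = proj₁ (covers-between (<⇒≤ w<j) j<n k<n ck)
      w≮k : ¬ w < k
      w≮k w<k = not-both k<n ck ((m≤n⇒m≤1+n (proj₁ (proj₁ ck)) , ≤-<-trans w<k (<R k<n)) , proj₂ ck)
      k≡w : k ≡ w
      k≡w = ≤-antisym (≮⇒≥ w≮k) w≤k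
      R≤w+1 : R w ≤ suc w
      R≤w+1 = ≮⇒≥ λ w+1<R → not-both k<n ck
        ((m≤n⇒m≤1+n (proj₁ (proj₁ ck)) , subst (λ v → suc w < R v) (sym k≡w) w+1<R) , proj₂ ck)
    ... | no w≮j = inj₂ (j≤w , ≤-antisym (L≤ w+1<n) w+1≤L , subst (λ v → T v ≤ j) m≡w+1 (proj₁ (proj₂ cm)))
      where
      j≤w : j ≤ w
      j≤w = ≮⇒≥ w≮j
      m≤w+1 = proj₂ (covers-between′ (m≤n⇒m≤1+n j≤w) w+1<n m<n cm)
      m≮w+1 : ¬ m < suc w
      m≮w+1 m≤w = not-both m<n ((≤-trans (L≤ m<n) (s≤s⁻¹ m≤w) , <-trans (n<1+n w) (proj₂ (proj₁ cm))) , proj₂ cm) cm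
      m≡w+1 : m ≡ suc w
      m≡w+1 = ≤-antisym m≤w+1 (≮⇒≥ m≮w+1)
      w+1≤L : suc w ≤ L (suc w)
      w+1≤L = ≮⇒≥ λ L<w+1 → not-both m<n
        ((subst (λ v → L v ≤ w) (sym m≡w+1) (s≤s⁻¹ L<w+1) , <-trans (n<1+n w) (proj₂ (proj₁ cm))) , proj₂ cm) cm

module _ {n} (τ : Tiling n) where
  open Tiling τ
  open Tiling (transpose τ) using () renaming (VEdge to HEdge)

  -- Each edge makes tile w or tile w + 1 reach past the diagonal point. If it is the same tile
  -- twice, it passes a line at which it also ends; if not, the two tiles overlap in the cell (w , w
  -- + 1) or (w + 1 , w).
  no-crossing-at-diagonal : ∀ {w j i} → suc w < n → VEdge (suc w) j → HEdge (suc w) i → ⊥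
  no-crossing-at-diagonal {w} w+1<n vedge hedge
    with vedge-classify τ w+1<n vedge | vedge-classify (transpose τ) w+1<n hedge
  ... | inj₁ (_ , R≡w+1 , _) | inj₁ (w<i , _ , i<R) = <⇒≱ (subst (_ <_) R≡w+1 i<R) w<i
  ... | inj₂ (j≤w , _ , T≤j) | inj₂ (_ , T≡w+1 , _) = <⇒≱ (subst (_≤ _) T≡w+1 T≤j) j≤w
  ... | inj₁ (w<j , _ , j<B) | inj₂ (i≤w , T≡w+1 , L≤i) = <⇒≢ (n<1+n w)
    (disjoint w<n w+1<n
      ((L≤ w<n , <R w<n) , (m≤n⇒m≤1+n (T≤ w<n) , ≤-<-trans w<j j<B))
      ((≤-trans L≤i i≤w , <-trans (n<1+n w) (<R w+1<n)) , proj₂ (covers-diagonal w+1<n)))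
    where w<n = <-trans (n<1+n w) w+1<n
  ... | inj₂ (j≤w , _ , T≤j) | inj₁ (w<i , _ , i<R) = <⇒≢ (n<1+n w)
    (disjoint w<n w+1<n
      ((m≤n⇒m≤1+n (L≤ w<n) , ≤-<-trans w<i i<R) , proj₂ (covers-diagonal w<n))
      (proj₁ (covers-diagonal w+1<n) , (≤-trans T≤j j≤w , <-trans (n<1+n w) (<B w+1<n))))
    where w<n = <-trans (n<1+n w) w+1<n

  -- Of the four unit edges at a crossing below the diagonal, the lower and the left one suffice:
  -- they extend tile w downwards and tile v + 1 to the left, into the common cell (w , v + 1).
  no-crossing-below-diagonal : ∀ {w v} → w < v → suc v < n →
                               VEdge (suc w) (suc v) → HEdge (suc v) w → ⊥
  no-crossing-below-diagonal {w} {v} w<v v+1<n vedge hedge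
    with vedge-classify τ (<-trans (s≤s w<v) v+1<n) vedge | vedge-classify (transpose τ) v+1<n hedge
  ... | inj₂ (v<w , _) | _ = <-asym w<v v<w
  ... | inj₁ _ | inj₁ (v<w , _) = <-asym w<v v<w
  ... | inj₁ (_ , _ , v+1<B) | inj₂ (_ , _ , L≤w) = <⇒≢ w<v+1
    (disjoint w<n v+1<n
      ((L≤ w<n , <R w<n) , (≤-trans (T≤ w<n) (<⇒≤ w<v+1) , v+1<B))
      ((L≤w , <-trans w<v+1 (<R v+1<n)) , proj₂ (covers-diagonal v+1<n)))
    where
    w<v+1 = m≤n⇒m≤1+n w<v
    w<n = <-trans w<v+1 v+1<n

module _ {n} (τ : Tiling n) where
  open Tiling τ
  open Tiling (transpose τ) using () renaming (VEdge to HEdge)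

  no-crossing : ∀ {w v} → suc w < n → suc v < n → VEdge (suc w) v → VEdge (suc w) (suc v) →
                HEdge (suc v) w → HEdge (suc v) (suc w) → ⊥
  no-crossing {w} {v} w+1<n v+1<n above below left right with <-cmp w v
  ... | tri< w<v _ _  = no-crossing-below-diagonal τ w<v v+1<n below left
  ... | tri≈ _ refl _ = no-crossing-at-diagonal τ w+1<n above left
  ... | tri> _ _ v<w  = no-crossing-below-diagonal (transpose τ) v<w w+1<n right above

-- Linear extensions

-- If i ≺ k (or k ≺ i) and j lies between i and k, then j is comparable with
-- i or with k in the same direction.  Together with asymmetry this already
-- excludes all cycles, although ≺ need not be transitive.
record IsBetweenRelation {n} (_≺_ : Rel (Fin n) 0ℓ) : Set where
  field
    _≺?_      : ∀ i j → Dec (i ≺ j)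
    asym      : ∀ {i j} → i ≺ j → ¬ j ≺ i
    between-< : ∀ {i j k} → i Fin.< j → j Fin.< k → i ≺ k → i ≺ j ⊎ j ≺ k
    between-> : ∀ {i j k} → i Fin.< j → j Fin.< k → k ≺ i → k ≺ j ⊎ j ≺ i

  Minimal : Fin n → Set
  Minimal k = ∀ m → ¬ m ≺ k

  minimal? : Decidable Minimal
  minimal? k = Fin.all? λ m → ¬? (m ≺? k)

  private
    Unblocked : Fin n → Set
    Unblocked k = ∀ m → m Fin.< k → ¬ m ≺ k

  -- Consider the largest k that has no predecessor on its left, and its
  -- smallest predecessor m on its right.  A predecessor of m on its left
  -- contradicts the choice of k or of m.
  ¬¬minimal : ∀ k → Unblocked k → ¬ ¬ (∃[ i ] Minimal i)
  ¬¬minimal k unblocked none = blocked k (Fin.>-wellFounded k) unblocked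
    where
    blocked : ∀ k → Acc Fin._>_ k → ¬ Unblocked k
    blocked k (acc larger) unblocked = none (k , minimal)
      where
      no-right : ∀ m → Acc Fin._<_ m → k Fin.< m → ¬ m ≺ k
      no-right m (acc smaller) k<m m≺k = blocked m (larger k<m) unblocked-m
        where
        unblocked-m : Unblocked m
        unblocked-m i i<m i≺m with Fin.<-cmp i k
        ... | tri< i<k _ _  = [ unblocked i i<k , asym m≺k ]′ (between-< i<k k<m i≺m)
        ... | tri≈ _ refl _ = asym m≺k i≺m
        ... | tri> _ _ k<i  = [ asym i≺m , no-right i (smaller i<m) k<i ]′ (between-> k<i i<m m≺k)
      minimal : Minimal k
      minimal m m≺k with Fin.<-cmp m k
      ... | tri< m<k _ _  = unblocked m m<k m≺k
      ... | tri≈ _ refl _ = asym m≺k m≺k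
      ... | tri> _ _ k<m  = no-right m (Fin.<-wellFounded m) k<m m≺k

∃-smallest : ∀ {n} {P : Fin n → Set} → Decidable P → ∃ P → ∃[ k ] P k × (∀ {m} → m Fin.< k → ¬ P m)
∃-smallest {n} {P} P? (k , pk) = search k (Fin.<-wellFounded k) pk
  where
  search : ∀ k → Acc Fin._<_ k → P k → ∃[ k ] P k × (∀ {m} → m Fin.< k → ¬ P m)
  search k (acc smaller) pk with Fin.any? (λ m → (m Fin.<? k) ×-dec P? m)
  ... | yes (m , m<k , pm) = search m (smaller m<k) pm
  ... | no none            = k , pk , λ {m} m<k pm → none (m , m<k , pm)

-- The second condition says that an element followed by a smaller one is the
-- reason why the smaller one did not come first.
record IsGreedyExtension {n} (_≺_ : Rel (Fin n) 0ℓ) (π : Permutation′ n) : Set where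
  field
    extends  : ∀ i j → (π ⟨$⟩ʳ i) ≺ (π ⟨$⟩ʳ j) → i Fin.< j
    descends : ∀ i j → toℕ j ≡ suc (toℕ i) → (π ⟨$⟩ʳ j) Fin.< (π ⟨$⟩ʳ i) →
               (π ⟨$⟩ʳ i) ≺ (π ⟨$⟩ʳ j)

module _ {n} {_≺_ : Rel (Fin (suc n)) 0ℓ} (rel : IsBetweenRelation _≺_) (s : Fin (suc n)) where
  open IsBetweenRelation rel

  private
    ↑ : Fin n → Fin (suc n)
    ↑ = punchIn s

    ↑-mono-< : ∀ {i j} → i Fin.< j → ↑ i Fin.< ↑ j
    ↑-mono-< {i} {j} i<j = ≰⇒> λ ↑j≤↑i → <⇒≱ i<j (Fin.punchIn-cancel-≤ s j i ↑j≤↑i)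

    ↑-cancel-< : ∀ {i j} → ↑ i Fin.< ↑ j → i Fin.< j
    ↑-cancel-< {i} {j} ↑i<↑j = ≰⇒> λ j≤i → <⇒≱ ↑i<↑j (Fin.punchIn-mono-≤ s j i j≤i)

  -- Betweenness refers only to the order of the labels, so it survives the monotone renumbering
  -- after `s` is removed.
  isBetweenRelation-punchIn : IsBetweenRelation λ i j → ↑ i ≺ ↑ j
  isBetweenRelation-punchIn = record
    { _≺?_      = λ i j → ↑ i ≺? ↑ j
    ; asym      = asym
    ; between-< = λ i<j j<k → between-< (↑-mono-< i<j) (↑-mono-< j<k)
    ; between-> = λ i<j j<k → between-> (↑-mono-< i<j) (↑-mono-< j<k)
    }

  isGreedyExtension-insert : ∀ {π} → Minimal s → (∀ {m} → m Fin.< s → ¬ Minimal m) →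
    IsGreedyExtension (λ i j → ↑ i ≺ ↑ j) π → IsGreedyExtension _≺_ (insert Fin.zero s π)
  isGreedyExtension-insert {π} s-minimal s-smallest greedy = record
    { extends = extends ; descends = descends }
    where
    module π = IsGreedyExtension greedy
    σ = insert Fin.zero s π

    extends : ∀ i j → (σ ⟨$⟩ʳ i) ≺ (σ ⟨$⟩ʳ j) → i Fin.< j
    extends Fin.zero    Fin.zero    s≺s = contradiction s≺s (asym s≺s)
    extends Fin.zero    (Fin.suc j) _   = z<s
    extends (Fin.suc i) Fin.zero    i≺s = contradiction i≺s (s-minimal _)
    extends (Fin.suc i) (Fin.suc j) i≺j = s≤s (π.extends i j i≺j)

    descends : ∀ i j → toℕ j ≡ suc (toℕ i) → (σ ⟨$⟩ʳ j) Fin.< (σ ⟨$⟩ʳ i) →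
               (σ ⟨$⟩ʳ i) ≺ (σ ⟨$⟩ʳ j)
    descends (Fin.suc i) (Fin.suc j) eq πj<πi = π.descends i j (suc-injective eq) (↑-cancel-< πj<πi)
    descends Fin.zero    (Fin.suc j) eq πj<s with Fin.any? (λ m → m ≺? ↑ (π ⟨$⟩ʳ j))
    ... | no none = contradiction (λ m m≺j → none (m , m≺j)) (s-smallest πj<s)
    ... | yes (m , m≺j) with s Fin.≟ m
    ...   | yes refl = m≺j
    ...   | no s≢m   = contradiction
      (π.extends i j (subst (_≺ ↑ (π ⟨$⟩ʳ j)) (sym ↑πi≡m) m≺j))
      (λ i<j → <⇒≱ i<j (subst (_≤ toℕ i) (sym (suc-injective eq)) z≤n))
      where
      i = π ⟨$⟩ˡ punchOut s≢m
      ↑πi≡m : ↑ (π ⟨$⟩ʳ i) ≡ m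
      ↑πi≡m = trans (cong ↑ (inverseʳ π)) (Fin.punchIn-punchOut s≢m)

greedyExtension : ∀ {n} {_≺_ : Rel (Fin n) 0ℓ} → IsBetweenRelation _≺_ → ∃ (IsGreedyExtension _≺_)
greedyExtension {zero}  rel = Perm.id , record { extends = λ () ; descends = λ () }
greedyExtension {suc n} rel =
  let s , s-minimal , s-smallest = ∃-smallest minimal?
        (decidable-stable (Fin.any? minimal?) (¬¬minimal Fin.zero λ _ ()))
      π , greedy = greedyExtension (isBetweenRelation-punchIn rel s)
  in insert Fin.zero s π , isGreedyExtension-insert rel s s-minimal s-smallest greedy
  where open IsBetweenRelation rel

-- The tiles of ρ(x)

-- A tile extends from its diagonal cell along a run of labels with a common property; this
-- describes where the run ends below k. Writing the stopping label as m with l ≡ suc m leaves l = 0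
-- without a condition.
record IsLower (Q : ℕ → Set) (k l : ℕ) : Set where
  field
    below  : l ≤ k
    inside : ∀ {m} → l ≤ m → m < k → Q m
    stop   : ∀ {m} → l ≡ suc m → ¬ Q m

  least : ∀ {i} → i ≤ k → (∀ {m} → i ≤ m → m < k → Q m) → l ≤ i
  least {i} i≤k q = ≮⇒≥ λ i<l → extend l refl i<l
    where
    extend : ∀ l′ → l ≡ l′ → ¬ i < l′
    extend (suc m) l≡m+1 (s≤s i≤m) = stop l≡m+1 (q i≤m (subst (_≤ k) l≡m+1 below))

record IsUpper (Q : ℕ → Set) (n k r : ℕ) : Set where
  field
    above  : k < r
    bound  : r ≤ n
    inside : ∀ {m} → k < m → m < r → Q m
    stop   : r < n → ¬ Q r

  greater : ∀ {j} → j < n → (∀ {m} → k < m → m ≤ j → Q m) → j < r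
  greater j<n q = ≰⇒> λ r≤j → stop (≤-<-trans r≤j j<n) (q above r≤j)

IsLower-unique : ∀ {Q k l l′} → IsLower Q k l → IsLower Q k l′ → l ≡ l′
IsLower-unique p q = ≤-antisym (p.least q.below q.inside) (q.least p.below p.inside)
  where
  module p = IsLower p
  module q = IsLower q

IsUpper-unique : ∀ {Q n k r r′} → IsUpper Q n k r → IsUpper Q n k r′ → r ≡ r′
IsUpper-unique p q = ≤-antisym (≮⇒≥ (longer p q)) (≮⇒≥ (longer q p))
  where
  longer : ∀ {Q n k r r′} → IsUpper Q n k r → IsUpper Q n k r′ → ¬ r′ < r
  longer p q r′<r = q.stop (<-≤-trans r′<r p.bound) (p.inside q.above r′<r)
    where
    module p = IsUpper p
    module q = IsUpper q

-- The tile named k in ρ(x), where i ⊏ j means that i stands before j in x.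
record IsTile (_⊏_ : Rel ℕ 0ℓ) (n k l r t b : ℕ) : Set where
  field
    isL : IsLower (k ⊏_) k l
    isR : IsUpper (_⊏ k) n k r
    isT : IsLower (_⊏ k) k t
    isB : IsUpper (k ⊏_) n k b

-- Reversing the permutation reflects the rectangulation in the diagonal, so that cells above the
-- diagonal need no separate treatment.
IsTile-transpose : ∀ {_⊏_ n k l r t b} → IsTile _⊏_ n k l r t b → IsTile (flip _⊏_) n k t b l r
IsTile-transpose tile = record { isL = isT ; isR = isB ; isT = isL ; isB = isR }
  where open IsTile tile

module _ {_⊏_ : Rel ℕ 0ℓ} (sto : IsStrictTotalOrder _≡_ _⊏_) where
  open IsStrictTotalOrder sto using (compare; asym) renaming (trans to ⊏-trans)

  IsFirst : ℕ → ℕ → ℕ → Set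
  IsFirst i j k = (i ≤ k × k ≤ j) × (∀ {m} → i ≤ m → m ≤ j → m ≡ k ⊎ k ⊏ m)

  IsFirst-unique : ∀ {i j k l} → IsFirst i j k → IsFirst i j l → k ≡ l
  IsFirst-unique ((i≤k , k≤j) , k-first) ((i≤l , l≤j) , l-first) with l-first i≤k k≤j | k-first i≤l l≤j
  ... | inj₁ k≡l | _        = k≡l
  ... | inj₂ _   | inj₁ l≡k = sym l≡k
  ... | inj₂ l⊏k | inj₂ k⊏l = contradiction k⊏l (asym l⊏k)

  first : ∀ {i j} → i ≤ j → ∃ (IsFirst i j)
  first {j = zero} z≤n = zero , (z≤n , z≤n) , λ { _ z≤n → inj₁ refl }
  first {i} {suc j} i≤1+j with i ≤? j
  ... | no i≰j = suc j , (i≤1+j , ≤-refl) , λ i≤m m≤1+j → inj₁ (≤-antisym m≤1+j (≤-trans (≰⇒> i≰j) i≤m))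
  ... | yes i≤j with first i≤j
  ...   | k , (i≤k , k≤j) , k-first with compare k (suc j)
  ...     | tri< k⊏1+j _ _ = k , (i≤k , m≤n⇒m≤1+n k≤j) , λ i≤m m≤1+j → case m≤n⇒m<n∨m≡n m≤1+j of λ where
            (inj₁ m<1+j) → k-first i≤m (s≤s⁻¹ m<1+j)
            (inj₂ refl)  → inj₂ k⊏1+j
  ...     | tri≈ _ k≡1+j _ = contradiction k≡1+j (<⇒≢ (s≤s k≤j))
  ...     | tri> _ _ 1+j⊏k = suc j , (i≤1+j , ≤-refl) , λ i≤m m≤1+j → case m≤n⇒m<n∨m≡n m≤1+j of λ where
            (inj₁ m<1+j) → inj₂ (case k-first i≤m (s≤s⁻¹ m<1+j) of λ where
              (inj₁ refl) → 1+j⊏k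
              (inj₂ k⊏m)  → ⊏-trans 1+j⊏k k⊏m)
            (inj₂ refl)  → inj₁ refl

  module _ {n k l r t b} (tile : IsTile _⊏_ n k l r t b) where
    open IsTile tile
    private
      module L = IsLower isL
      module R = IsUpper isR
      module T = IsLower isT
      module B = IsUpper isB

    -- If k < i, then label k + 1 would be in the run to the right and in the run below, hence both
    -- before and after k; if j < k, the same happens to label j on the left and above. With k
    -- inside the interval, the left and the lower run contain all its other labels.
    covers⇒first : ∀ {i j} → i ≤ j → (l ≤ i × i < r) × (t ≤ j × j < b) → IsFirst i j k
    covers⇒first {i} {j} i≤j ((l≤i , i<r) , (t≤j , j<b)) = (≮⇒≥ k≮i , ≮⇒≥ j≮k) , k-first
      where
      k≮i : ¬ k < i
      k≮i k<i = asym (R.inside (n<1+n k) (≤-<-trans k<i i<r))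
                     (B.inside (n<1+n k) (≤-<-trans (≤-trans k<i i≤j) j<b))
      j≮k : ¬ j < k
      j≮k j<k = asym (L.inside (≤-trans l≤i i≤j) j<k) (T.inside t≤j j<k)
      k-first : ∀ {m} → i ≤ m → m ≤ j → m ≡ k ⊎ k ⊏ m
      k-first {m} i≤m m≤j with <-cmp m k
      ... | tri< m<k _ _ = inj₂ (L.inside (≤-trans l≤i i≤m) m<k)
      ... | tri≈ _ m≡k _ = inj₁ m≡k
      ... | tri> _ _ k<m = inj₂ (B.inside k<m (≤-<-trans m≤j j<b))

    first⇒covers : ∀ {i j} → j < n → IsFirst i j k → (l ≤ i × i < r) × (t ≤ j × j < b)
    first⇒covers {i} {j} j<n ((i≤k , k≤j) , k-first) =
      (L.least i≤k (λ i≤m m<k → strict (<⇒≢ m<k) (k-first i≤m (≤-trans (<⇒≤ m<k) k≤j))) , ≤-<-trans i≤k R.above) ,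
      (≤-trans T.below k≤j , B.greater j<n λ k<m m≤j → strict (>⇒≢ k<m) (k-first (≤-trans i≤k (<⇒≤ k<m)) m≤j))
      where
      strict : ∀ {m} → m ≢ k → m ≡ k ⊎ k ⊏ m → k ⊏ m
      strict m≢k (inj₁ m≡k) = contradiction m≡k m≢k
      strict m≢k (inj₂ k⊏m) = k⊏m

  IsTile-unique : ∀ {n k l r t b l′ r′ t′ b′} → IsTile _⊏_ n k l r t b → IsTile _⊏_ n k l′ r′ t′ b′ →
                  (l ≡ l′ × r ≡ r′) × (t ≡ t′ × b ≡ b′)
  IsTile-unique p q = (IsLower-unique p.isL q.isL , IsUpper-unique p.isR q.isR) ,
                      (IsLower-unique p.isT q.isT , IsUpper-unique p.isB q.isB)
    where
    module p = IsTile p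
    module q = IsTile q

module _ {_⊏_ : Rel ℕ 0ℓ} (sto : IsStrictTotalOrder _≡_ _⊏_) {n} (L R T B : ℕ → ℕ)
         (isTile : ∀ {k} → k < n → IsTile _⊏_ n k (L k) (R k) (T k) (B k)) where

  private
    sto′ : IsStrictTotalOrder _≡_ (flip _⊏_)
    sto′ = Flip.isStrictTotalOrder sto

    isTile′ : ∀ {k} → k < n → IsTile (flip _⊏_) n k (T k) (B k) (L k) (R k)
    isTile′ k<n = IsTile-transpose (isTile k<n)

    module Tile {k} (k<n : k < n) = IsTile (isTile k<n)

  -- The cell (i , j) belongs to the first of the tiles named i, …, j if i ≤ j
  -- and to the last of those named j, …, i if j ≤ i.
  tiling : Tiling n
  tiling = record
    { L = L ; R = R ; T = T ; B = B
    ; L≤ = λ k<n → IsLower.below (Tile.isL k<n)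
    ; <R = λ k<n → IsUpper.above (Tile.isR k<n)
    ; R≤ = λ k<n → IsUpper.bound (Tile.isR k<n)
    ; T≤ = λ k<n → IsLower.below (Tile.isT k<n)
    ; <B = λ k<n → IsUpper.above (Tile.isB k<n)
    ; B≤ = λ k<n → IsUpper.bound (Tile.isB k<n)
    ; cover = cover
    ; disjoint = disjoint
    }
    where
    cover : ∀ {i j} → i < n → j < n → ∃[ k ] k < n × (L k ≤ i × i < R k) × (T k ≤ j × j < B k)
    cover {i} {j} i<n j<n with ≤-total i j
    ... | inj₁ i≤j = let k , f = first sto i≤j
                         k<n = ≤-<-trans (proj₂ (proj₁ f)) j<n
                     in k , k<n , first⇒covers sto (isTile k<n) j<n f
    ... | inj₂ j≤i = let k , f = first sto′ j≤i
                         k<n = ≤-<-trans (proj₂ (proj₁ f)) i<n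
                     in k , k<n , swap (first⇒covers sto′ (isTile′ k<n) i<n f)

    disjoint : ∀ {k m i j} → k < n → m < n →
               (L k ≤ i × i < R k) × (T k ≤ j × j < B k) →
               (L m ≤ i × i < R m) × (T m ≤ j × j < B m) → k ≡ m
    disjoint {i = i} {j} k<n m<n c d with ≤-total i j
    ... | inj₁ i≤j = IsFirst-unique sto (covers⇒first sto (isTile k<n) i≤j c) (covers⇒first sto (isTile m<n) i≤j d)
    ... | inj₂ j≤i = IsFirst-unique sto′ (covers⇒first sto′ (isTile′ k<n) j≤i (swap c))
                                         (covers⇒first sto′ (isTile′ m<n) j≤i (swap d))

-- Drawing the rectangles one at a time

∸-flip-≤ : ∀ {n a j} → j ≤ n → a ≤ n ∸ j → j ≤ n ∸ a
∸-flip-≤ {n} {a} j≤n a≤n∸j = subst (_≤ n ∸ a) (m∸[m∸n]≡n j≤n) (∸-monoʳ-≤ n a≤n∸j)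

∸-flip-≥ : ∀ {n a j} → j ≤ n → n ∸ j ≤ a → n ∸ a ≤ j
∸-flip-≥ {n} {a} j≤n n∸j≤a = subst (n ∸ a ≤_) (m∸[m∸n]≡n j≤n) (∸-monoʳ-≤ n n∸j≤a)

module _ {P : ℕ → Set} (P? : Decidable P) where

  greatest-≤ : ∀ b → greatest P? b ≤ b
  greatest-≤ zero = z≤n
  greatest-≤ (suc b) with P? (suc b)
  ... | yes _ = ≤-refl
  ... | no _  = m≤n⇒m≤1+n (greatest-≤ b)

  greatest-satisfies : P 0 → ∀ b → P (greatest P? b)
  greatest-satisfies p₀ zero = p₀
  greatest-satisfies p₀ (suc b) with P? (suc b)
  ... | yes p = p
  ... | no _  = greatest-satisfies p₀ b

  ≤-greatest : ∀ {m} b → m ≤ b → P m → m ≤ greatest P? b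
  ≤-greatest zero m≤0 _ = m≤0
  ≤-greatest (suc b) m≤b+1 p with P? (suc b)
  ... | yes _ = m≤b+1
  ... | no ¬p with m≤n⇒m<n∨m≡n m≤b+1
  ...   | inj₁ m<b+1 = ≤-greatest b (s≤s⁻¹ m<b+1) p
  ...   | inj₂ refl  = contradiction p ¬p

record IsTileRect (_⊏_ : Rel ℕ 0ℓ) (n k : ℕ) (r : Rect) : Set where
  field
    isTile : IsTile _⊏_ n k (left r) (right r) (n ∸ top r) (n ∸ bottom r)
    top≤    : top r ≤ n
    bottom≤ : bottom r ≤ n

Precedes : (ℕ → ℕ) → Rel ℕ 0ℓ
Precedes P a b = P a < P b

module _ {P : ℕ → ℕ} (P-injective : ∀ {a b} → P a ≡ P b → a ≡ b) where

  Precedes-isStrictTotalOrder : IsStrictTotalOrder _≡_ (Precedes P)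
  Precedes-isStrictTotalOrder = record
    { isStrictPartialOrder = record
      { isEquivalence = isEquivalence
      ; irrefl = λ { refl → <-irrefl refl }
      ; trans = <-trans
      ; <-resp-≈ = (λ { refl p → p }) , (λ { refl p → p })
      }
    ; compare = compare
    }
    where
    compare : ∀ a b → Tri (Precedes P a b) (a ≡ b) (Precedes P b a)
    compare a b with <-cmp (P a) (P b)
    ... | tri< p q r = tri< p (q ∘ cong P) r
    ... | tri≈ p q r = tri≈ p (P-injective q) r
    ... | tri> p q r = tri> p (q ∘ cong P) r

  ¬Precedes⇒Precedes : ∀ {a b} → ¬ Precedes P a b → a ≢ b → Precedes P b a
  ¬Precedes⇒Precedes ¬a⊏b a≢b = ≤∧≢⇒< (≮⇒≥ ¬a⊏b) (a≢b ∘ sym ∘ P-injective)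

-- The invariant of the drawing. A rectangle is final once drawn, so it can be described through the
-- order of all labels, although only those at positions below s have been read.
record Drawn (n : ℕ) (P : ℕ → ℕ) (s : ℕ) (Rs : List Rect) : Set where
  field
    tile-of   : ∀ {k} → k < n → P k < s → ∃[ r ] r ∈ Rs × IsTileRect (Precedes P) n k r
    is-a-tile : ∀ {r} → r ∈ Rs → ∃[ k ] (k < n × P k < s) × IsTileRect (Precedes P) n k r

module DrawnProperties {n P s Rs} (P-injective : ∀ {a b} → P a ≡ P b → a ≡ b) (drawn : Drawn n P s Rs) where
  open Drawn drawn

  private
    Closed : Rect → ℕ → ℕ → Set
    Closed r x j = (left r ≤ x × x ≤ right r) × (n ∸ top r ≤ j × j ≤ n ∸ bottom r)

    inT⇒ : ∀ {x j} → j ≤ n → Any ((x , n ∸ j) ∈ᴿ_) Rs →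
           ∃[ k ] ∃[ r ] (k < n × P k < s) × IsTileRect (Precedes P) n k r × Closed r x j
    inT⇒ j≤n inT =
      let r , r∈Rs , cols , (bottom≤ , ≤top) = find inT
          k , k<n,Pk<s , t = is-a-tile r∈Rs
      in k , r , k<n,Pk<s , t , cols , ∸-flip-≥ j≤n ≤top , ∸-flip-≤ j≤n bottom≤

    ⇒inT : ∀ {x j k} → j ≤ n → k < n → P k < s →
           (∀ {r} → IsTileRect (Precedes P) n k r → Closed r x j) → InT Rs (x , n ∸ j)
    ⇒inT j≤n k<n Pk<s closed =
      let r , r∈Rs , t = tile-of k<n Pk<s
          open IsTileRect t
          cols , (t≤j , j≤b) = closed t
      in inj₂ (lose r∈Rs (cols , ∸-flip-≤ bottom≤ j≤b , ∸-flip-≥ top≤ t≤j))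

  -- Apart from the edges of S, T is the union of the rectangles with upper
  -- right corner (b + 1 , n - a) for the intervals [a , b] of drawn labels.
  -- For x ≤ j such a rectangle contains (x , n - j) if the interval meets
  -- [x - 1 , j], and for j < x if the interval contains [j , x).
  below⇒ : ∀ {x j} → x ≤ j → j ≤ n → InT Rs (x , n ∸ j) →
           x ≡ 0 ⊎ j ≡ n ⊎ ∃[ e ] (e < n × P e < s) × x ≤ suc e × e ≤ j
  below⇒ x≤j j≤n (inj₁ (inj₁ x≡0)) = inj₁ x≡0
  below⇒ x≤j j≤n (inj₁ (inj₂ n∸j≡0)) = inj₂ (inj₁ (≤-antisym j≤n (m∸n≡0⇒m≤n n∸j≡0)))
  below⇒ {x} {j} x≤j j≤n (inj₂ inT) with inT⇒ j≤n inT
  ... | k , r , k<n,Pk<s , tileRect , (l≤x , x≤r) , (t≤j , j≤b) = inj₂ (inj₂ (k , k<n,Pk<s , ≮⇒≥ k+1≮x , ≮⇒≥ j≮k))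
    where
    open IsTileRect tileRect
    open IsTile isTile
    k+1≮x : ¬ suc k < x
    k+1≮x k+1<x = <-asym (IsUpper.inside isR (n<1+n k) (<-≤-trans k+1<x x≤r))
                         (IsUpper.inside isB (n<1+n k) (<-≤-trans k+1<x (≤-trans x≤j j≤b)))
    j≮k : ¬ j < k
    j≮k j<k = <-asym (IsLower.inside isL (≤-trans l≤x x≤j) j<k) (IsLower.inside isT t≤j j<k)

  -- Off the edges of S, the point is the upper right corner of the cell (x - 1 , j), which belongs
  -- to the first of the labels x - 1, ..., j. As soon as any of these is drawn, so is the first.
  ⇒below : ∀ {x j} → x ≤ j → j ≤ n → ∀ {e} → e < n → P e < s → x ≤ suc e → e ≤ j → InT Rs (x , n ∸ j)
  ⇒below {zero} _ _ _ _ _ _ = inj₁ (inj₁ refl)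
  ⇒below {suc x} {j} x<j j≤n {e} e<n Pe<s (s≤s x≤e) e≤j with m≤n⇒m<n∨m≡n j≤n
  ... | inj₂ refl = inj₁ (inj₂ (n∸n≡0 n))
  ... | inj₁ j<n  = ⇒inT j≤n k<n Pk<s closed
    where
    f = first (Precedes-isStrictTotalOrder P-injective) (<⇒≤ x<j)
    k = proj₁ f
    k<n = ≤-<-trans (proj₂ (proj₁ (proj₂ f))) j<n
    Pk<s : P k < s
    Pk<s = [ (λ { refl → Pe<s }) , (λ k⊏e → <-trans k⊏e Pe<s) ]′ (proj₂ (proj₂ f) x≤e e≤j)
    closed : ∀ {r} → IsTileRect (Precedes P) n k r → Closed r (suc x) j
    closed t with first⇒covers (Precedes-isStrictTotalOrder P-injective) (IsTileRect.isTile t) j<n (proj₂ f)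
    ... | (l≤x , x<r) , (t≤j , j<b) = (m≤n⇒m≤1+n l≤x , x<r) , (t≤j , <⇒≤ j<b)

  above⇒ : ∀ {x j} → j < x → x ≤ n → InT Rs (x , n ∸ j) → ∀ {e} → j ≤ e → e < x → P e < s
  above⇒ j<x x≤n (inj₁ (inj₁ refl)) = contradiction j<x λ ()
  above⇒ j<x x≤n (inj₁ (inj₂ n∸j≡0)) = contradiction (m∸n≡0⇒m≤n n∸j≡0) (<⇒≱ (<-≤-trans j<x x≤n))
  above⇒ {x} {j} j<x x≤n (inj₂ inT) {e} j≤e e<x with inT⇒ (≤-trans (<⇒≤ j<x) x≤n) inT
  ... | k , r , (k<n , Pk<s) , tileRect , (l≤x , x≤r) , (t≤j , j≤b) with <-cmp e k
  ...   | tri< e<k _ _  = <-trans (IsLower.inside (IsTile.isT (IsTileRect.isTile tileRect)) (≤-trans t≤j j≤e) e<k) Pk<s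
  ...   | tri≈ _ refl _ = Pk<s
  ...   | tri> _ _ k<e  = <-trans (IsUpper.inside (IsTile.isR (IsTileRect.isTile tileRect)) k<e (<-≤-trans e<x x≤r)) Pk<s

  -- The corner of the same cell, which now belongs to the last of the labels j, ..., x - 1; it is
  -- found as the first in the reversed order.
  ⇒above : ∀ {x j} → j < x → x ≤ n → (∀ {e} → j ≤ e → e < x → P e < s) → InT Rs (x , n ∸ j)
  ⇒above {suc x} {j} (s≤s j≤x) x<n drawn = ⇒inT (≤-trans j≤x (<⇒≤ x<n)) k<n (drawn j≤k (s≤s k≤x)) closed
    where
    sto = Flip.isStrictTotalOrder (Precedes-isStrictTotalOrder P-injective)
    f = first sto j≤x
    k = proj₁ f
    j≤k = proj₁ (proj₁ (proj₂ f))
    k≤x = proj₂ (proj₁ (proj₂ f))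
    k<n = ≤-<-trans k≤x x<n
    closed : ∀ {r} → IsTileRect (Precedes P) n k r → Closed r (suc x) j
    closed t with first⇒covers sto (IsTile-transpose (IsTileRect.isTile t)) x<n (proj₂ f)
    ... | (t≤j , j<b) , (l≤x , x<r) = (m≤n⇒m≤1+n l≤x , x<r) , (t≤j , <⇒≤ j<b)

if-elim : ∀ {P : Set} (d : Dec P) {A : Set} (C : A → Set) {x y : A} →
          (P → C x) → (¬ P → C y) → C (if does d then x else y)
if-elim (yes p) C f g = f p
if-elim (no ¬p) C f g = g ¬p

module _ {n P Rs e} (P-injective : ∀ {a b} → P a ≡ P b → a ≡ b)
         (e<n : e < n) (drawn : Drawn n P (P e) Rs) where
  open Drawn drawn
  open DrawnProperties P-injective drawn

  private
    infix 4 _⊏_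
    _⊏_ : Rel ℕ 0ℓ
    _⊏_ = Precedes P

    later : ∀ {m} → ¬ m ⊏ e → m ≢ e → e ⊏ m
    later = ¬Precedes⇒Precedes P-injective

    e≤n = <⇒≤ e<n

    rightmost-∈ : ∀ y b → InT Rs (rightmost Rs y b , y)
    rightmost-∈ y = greatest-satisfies (λ x → inT? Rs (x , y)) (inj₁ (inj₁ refl))

    rightmost-≤ : ∀ y b → rightmost Rs y b ≤ b
    rightmost-≤ y = greatest-≤ (λ x → inT? Rs (x , y))

    ≤-rightmost : ∀ y {x} b → x ≤ b → InT Rs (x , y) → x ≤ rightmost Rs y b
    ≤-rightmost y = ≤-greatest (λ x → inT? Rs (x , y))

    highest-∈ : ∀ x b → InT Rs (x , highest Rs x b)
    highest-∈ x = greatest-satisfies (λ y → inT? Rs (x , y)) (inj₁ (inj₂ refl))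

    highest-≤ : ∀ x b → highest Rs x b ≤ b
    highest-≤ x = greatest-≤ (λ y → inT? Rs (x , y))

    ≤-highest : ∀ x {y} b → y ≤ b → InT Rs (x , y) → y ≤ highest Rs x b
    ≤-highest x = ≤-greatest (λ y → inT? Rs (x , y))

  IsTopLeft IsBottomRight : Point → Set
  IsTopLeft (l , h) = IsLower (e ⊏_) e l × IsLower (_⊏ e) e (n ∸ h) × h ≤ n
  IsBottomRight (r , h) = IsUpper (_⊏ e) n e r × IsUpper (e ⊏_) n e (n ∸ h) × h ≤ n

  -- Only the labels e - 1 and e decide whether p lies in T, and e is not yet drawn. So p is in T
  -- exactly if e = 0 or e - 1 stands before e, and then the left run is empty; otherwise the upper
  -- run is empty. The remaining side is found by the search for the extreme point of T.
  topLeft-correct : IsTopLeft (topLeft n Rs (e , n ∸ e))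
  topLeft-correct = if-elim (inT? Rs (e , n ∸ e)) IsTopLeft inside outside
    where
    inside : InT Rs (e , n ∸ e) → IsTopLeft (e , highest Rs e n)
    inside p∈T = at-e , record { below = t≤e ; inside = drawn-between ; stop = stop } , h≤n
      where
      h   = highest Rs e n
      h≤n = highest-≤ e n
      h≡  : h ≡ n ∸ (n ∸ h)
      h≡  = sym (m∸[m∸n]≡n h≤n)
      t≤e : n ∸ h ≤ e
      t≤e = ∸-flip-≥ e≤n (≤-highest e n (m∸n≤m n e) p∈T)
      at-e : IsLower (e ⊏_) e e
      at-e = record { below = ≤-refl ; inside = λ e≤m m<e → contradiction e≤m (<⇒≱ m<e) ; stop = stop }
        where
        stop : ∀ {m} → e ≡ suc m → ¬ e ⊏ m
        stop e≡m+1 e⊏m with below⇒ ≤-refl e≤n p∈T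
        ... | inj₁ e≡0 = 1+n≢0 (trans (sym e≡m+1) e≡0)
        ... | inj₂ (inj₁ e≡n) = <⇒≢ e<n e≡n
        ... | inj₂ (inj₂ (f , (_ , f⊏e) , e≤f+1 , f≤e)) with m≤n⇒m<n∨m≡n f≤e
        ...   | inj₂ refl = <-irrefl refl f⊏e
        ...   | inj₁ f<e  = <-asym (subst (_⊏ e) f≡m f⊏e) e⊏m
          where f≡m = suc-injective (trans (≤-antisym f<e e≤f+1) e≡m+1)
      drawn-between : ∀ {m} → n ∸ h ≤ m → m < e → m ⊏ e
      drawn-between t≤m m<e = above⇒ (≤-<-trans t≤m m<e) e≤n
        (subst (λ y → InT Rs (e , y)) h≡ (highest-∈ e n)) t≤m m<e
      stop : ∀ {m} → n ∸ h ≡ suc m → ¬ m ⊏ e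
      stop {m} t≡m+1 m⊏e = <⇒≱ m<t (∸-flip-≥ m≤n (≤-highest e n (m∸n≤m n m) (⇒above m<e e≤n all)))
        where
        m<t : m < n ∸ h
        m<t = ≤-reflexive (sym t≡m+1)
        m<e = <-≤-trans m<t t≤e
        m≤n = <⇒≤ (<-trans m<e e<n)
        all : ∀ {f} → m ≤ f → f < e → f ⊏ e
        all {f} m≤f f<e with m≤n⇒m<n∨m≡n m≤f
        ... | inj₁ m<f  = drawn-between (subst (_≤ f) (sym t≡m+1) m<f) f<e
        ... | inj₂ refl = m⊏e
    outside : ¬ InT Rs (e , n ∸ e) → IsTopLeft (rightmost Rs (n ∸ e) e , n ∸ e)
    outside p∉T = record { below = l≤e ; inside = undrawn-between ; stop = stop } , at-e , m∸n≤m n e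
      where
      l = rightmost Rs (n ∸ e) e
      l≤e = rightmost-≤ (n ∸ e) e
      undrawn-between : ∀ {m} → l ≤ m → m < e → e ⊏ m
      undrawn-between {m} l≤m m<e = later (λ m⊏e → <⇒≱ (s≤s l≤m)
        (≤-rightmost (n ∸ e) e m<e (⇒below m<e e≤n (<-trans m<e e<n) m⊏e ≤-refl (<⇒≤ m<e)))) (<⇒≢ m<e)
      stop : ∀ {m} → l ≡ suc m → ¬ e ⊏ m
      stop {m} l≡m+1 e⊏m with below⇒ l≤e e≤n (rightmost-∈ (n ∸ e) e)
      ... | inj₁ l≡0 = 1+n≢0 (trans (sym l≡m+1) l≡0)
      ... | inj₂ (inj₁ e≡n) = <⇒≢ e<n e≡n
      ... | inj₂ (inj₂ (f , (_ , f⊏e) , l≤f+1 , f≤e)) with m≤n⇒m<n∨m≡n f≤e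
      ...   | inj₂ refl = <-irrefl refl f⊏e
      ...   | inj₁ f<e with m≤n⇒m<n∨m≡n l≤f+1
      ...     | inj₁ l<f+1 = <-asym f⊏e (undrawn-between (s≤s⁻¹ l<f+1) f<e)
      ...     | inj₂ l≡f+1 = <-asym (subst (_⊏ e) (suc-injective (trans (sym l≡f+1) l≡m+1)) f⊏e) e⊏m
      at-e : IsLower (_⊏ e) e (n ∸ (n ∸ e))
      at-e = subst (IsLower (_⊏ e) e) (sym (m∸[m∸n]≡n e≤n)) record
        { below = ≤-refl ; inside = λ e≤m m<e → contradiction e≤m (<⇒≱ m<e)
        ; stop = λ {m} e≡m+1 m⊏e → p∉T (⇒below ≤-refl e≤n
            (<-trans (subst (m <_) (sym e≡m+1) (n<1+n m)) e<n) m⊏e (≤-reflexive e≡m+1)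
            (subst (m ≤_) (sym e≡m+1) (n≤1+n m))) }

  -- Here e and e + 1 are the deciding labels: the point is in T exactly if e + 1 = n or e + 1
  -- stands before e. In that case the lower run is empty, otherwise the right one.
  bottomRight-correct : IsBottomRight (bottomRight n Rs (suc e , n ∸ suc e))
  bottomRight-correct = if-elim (inT? Rs (suc e , n ∸ suc e)) IsBottomRight inside outside
    where
    nothing-between : ∀ {Q : ℕ → Set} {m} → e < m → m < suc e → Q m
    nothing-between e<m m<e+1 = contradiction e<m (≤⇒≯ (s≤s⁻¹ m<e+1))
    inside : InT Rs (suc e , n ∸ suc e) → IsBottomRight (rightmost Rs (n ∸ suc e) n , n ∸ suc e)
    inside p∈T = record { above = e<r ; bound = r≤n ; inside = drawn-between ; stop = stop } , at-e+1 , m∸n≤m n (suc e)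
      where
      r = rightmost Rs (n ∸ suc e) n
      r≤n = rightmost-≤ (n ∸ suc e) n
      e<r : e < r
      e<r = ≤-rightmost (n ∸ suc e) n e<n p∈T
      drawn-between : ∀ {m} → e < m → m < r → m ⊏ e
      drawn-between e<m m<r = above⇒ (≤-<-trans e<m m<r) r≤n (rightmost-∈ (n ∸ suc e) n) e<m m<r
      stop : r < n → ¬ r ⊏ e
      stop r<n r⊏e = <-irrefl refl (≤-rightmost (n ∸ suc e) n r<n (⇒above (s≤s e<r) r<n all))
        where
        all : ∀ {f} → suc e ≤ f → f < suc r → f ⊏ e
        all e<f f≤r with m≤n⇒m<n∨m≡n (s≤s⁻¹ f≤r)
        ... | inj₁ f<r  = drawn-between e<f f<r
        ... | inj₂ refl = r⊏e
      at-e+1 : IsUpper (e ⊏_) n e (n ∸ (n ∸ suc e))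
      at-e+1 = subst (IsUpper (e ⊏_) n e) (sym (m∸[m∸n]≡n e<n)) record
        { above = ≤-refl ; bound = e<n ; inside = nothing-between {e ⊏_} ; stop = stop′ }
        where
        stop′ : suc e < n → ¬ e ⊏ suc e
        stop′ e+1<n e⊏e+1 with below⇒ ≤-refl e<n p∈T
        ... | inj₂ (inj₁ e+1≡n) = <⇒≢ e+1<n e+1≡n
        ... | inj₂ (inj₂ (f , (_ , f⊏e) , e+1≤f+1 , f≤e+1)) with m≤n⇒m<n∨m≡n f≤e+1
        ...   | inj₂ refl  = <-asym f⊏e e⊏e+1
        ...   | inj₁ f<e+1 = <-irrefl (cong P (≤-antisym (s≤s⁻¹ f<e+1) (s≤s⁻¹ e+1≤f+1))) f⊏e
    outside : ¬ InT Rs (suc e , n ∸ suc e) → IsBottomRight (suc e , highest Rs (suc e) (n ∸ suc e))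
    outside p∉T = at-e+1 , record { above = e<b ; bound = m∸n≤m n h ; inside = undrawn-between ; stop = stop } , h≤n
      where
      h = highest Rs (suc e) (n ∸ suc e)
      h≤ : h ≤ n ∸ suc e
      h≤ = highest-≤ (suc e) (n ∸ suc e)
      h≤n = ≤-trans h≤ (m∸n≤m n (suc e))
      h≡ : h ≡ n ∸ (n ∸ h)
      h≡ = sym (m∸[m∸n]≡n h≤n)
      e<b : e < n ∸ h
      e<b = ∸-flip-≤ e<n h≤
      at-e+1 : IsUpper (_⊏ e) n e (suc e)
      at-e+1 = record { above = ≤-refl ; bound = e<n ; inside = nothing-between {_⊏ e}
        ; stop = λ e+1<n e+1⊏e → p∉T (⇒below ≤-refl e<n e+1<n e+1⊏e (n≤1+n _) ≤-refl) }
      undrawn-between : ∀ {m} → e < m → m < n ∸ h → e ⊏ m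
      undrawn-between {m} e<m m<b = later (λ m⊏e → <⇒≱ m<b (∸-flip-≥ m≤n
          (≤-highest (suc e) (n ∸ suc e) (∸-monoʳ-≤ n e<m)
            (⇒below e<m m≤n m<n m⊏e (m≤n⇒m≤1+n e<m) ≤-refl)))) (>⇒≢ e<m)
        where
        m<n = <-≤-trans m<b (m∸n≤m n h)
        m≤n = <⇒≤ m<n
      stop : n ∸ h < n → ¬ e ⊏ (n ∸ h)
      stop b<n e⊏b with below⇒ e<b (m∸n≤m n h) (subst (λ y → InT Rs (suc e , y)) h≡ (highest-∈ (suc e) (n ∸ suc e)))
      ... | inj₂ (inj₁ b≡n) = <⇒≢ b<n b≡n
      ... | inj₂ (inj₂ (f , (_ , f⊏e) , e+1≤f+1 , f≤b)) with m≤n⇒m<n∨m≡n f≤b | m≤n⇒m<n∨m≡n (s≤s⁻¹ e+1≤f+1)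
      ...   | inj₂ refl | _         = <-asym f⊏e e⊏b
      ...   | inj₁ f<b  | inj₁ e<f  = <-asym f⊏e (undrawn-between e<f f<b)
      ...   | inj₁ _    | inj₂ refl = <-irrefl refl f⊏e

  Drawn-draw : Drawn n P (suc (P e)) (fromCorners (topLeft n Rs (e , n ∸ e)) (bottomRight n Rs (suc e , n ∸ suc e)) ∷ Rs)
  Drawn-draw = record { tile-of = tile-of′ ; is-a-tile = is-a-tile′ }
    where
    new : IsTileRect _⊏_ n e (fromCorners (topLeft n Rs (e , n ∸ e)) (bottomRight n Rs (suc e , n ∸ suc e)))
    new = let l , t , t≤ = topLeft-correct
              r , b , b≤ = bottomRight-correct
          in record { isTile = record { isL = l ; isR = r ; isT = t ; isB = b } ; top≤ = t≤ ; bottom≤ = b≤ }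
    tile-of′ : ∀ {k} → k < n → P k < suc (P e) → _
    tile-of′ k<n Pk≤Pe with m≤n⇒m<n∨m≡n (s≤s⁻¹ Pk≤Pe)
    ... | inj₁ Pk<Pe = let r , r∈ , t = tile-of k<n Pk<Pe in r , there r∈ , t
    ... | inj₂ Pk≡Pe with refl ← P-injective Pk≡Pe = _ , here refl , new
    is-a-tile′ : ∀ {r} → r ∈ _ → _
    is-a-tile′ (here refl) = e , (e<n , ≤-refl) , new
    is-a-tile′ (there r∈)  = let k , (k<n , Pk<Pe) , t = is-a-tile r∈ in k , (k<n , m≤n⇒m≤1+n Pk<Pe) , t

Drawn-[] : ∀ {n P} → Drawn n P 0 []
Drawn-[] = record { tile-of = λ _ () ; is-a-tile = λ () }

Drawn-foldl : ∀ {n P m s Rs} → (∀ {a b} → P a ≡ P b → a ≡ b) →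
              (f : Fin m → Fin n) → (∀ i → P (toℕ (f i)) ≡ s + toℕ i) →
              Drawn n P s Rs → Drawn n P (s + m) (foldl (draw n) Rs (tabulate f))
Drawn-foldl {n} {P} {zero} {s} {Rs} _ f _ drawn = subst (λ s → Drawn n P s Rs) (sym (+-identityʳ s)) drawn
Drawn-foldl {n} {P} {suc m} {s} {Rs} P-injective f position drawn =
  subst (λ t → Drawn n P t (foldl (draw n) Rs (tabulate f))) (sym (+-suc s m))
    (Drawn-foldl P-injective (f ∘ Fin.suc) (λ i → trans (position (Fin.suc i)) (+-suc s (toℕ i)))
      (subst (λ t → Drawn n P (suc t) (draw n Rs (f Fin.zero))) first-position
        (Drawn-draw P-injective (Fin.toℕ<n (f Fin.zero))
          (subst (λ t → Drawn n P t Rs) (sym first-position) drawn))))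
  where
  first-position : P (toℕ (f Fin.zero)) ≡ s
  first-position = trans (position Fin.zero) (+-identityʳ s)

-- The order of the labels in a permutation, and the tiling of its image

record Represents {n} (τ : Tiling n) (Rs : List Rect) : Set where
  open Tiling τ
  field
    box∈ : ∀ {k} → k < n → box k ∈ Rs
    ∈box : ∀ {r} → r ∈ Rs → ∃[ k ] k < n × r ≡ box k

-- The sides of a `Tiling` are functions on all of ℕ, so a choice made for the labels below n is
-- completed by a default.
choose : ∀ {n} {A : Set} {P : ℕ → A → Set} → A → (∀ k → k < n → ∃ (P k)) →
         Σ[ f ∈ (ℕ → A) ] (∀ {k} → k < n → P k (f k))
choose {n} {A} {P} a exists = f , f-correct
  where
  f : ℕ → A
  f k with k <? n
  ... | yes k<n = proj₁ (exists k k<n)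
  ... | no _    = a
  f-correct : ∀ {k} → k < n → P k (f k)
  f-correct {k} k<n with k <? n
  ... | yes k<n′ = proj₂ (exists k k<n′)
  ... | no k≮n   = contradiction k<n k≮n

module _ {n} (x : Permutation′ n) where

  -- The value for arguments that are not labels only serves to make the
  -- function injective.
  position : ℕ → ℕ
  position k with k <? n
  ... | yes k<n = toℕ (x ⟨$⟩ˡ fromℕ< k<n)
  ... | no _    = k

  position-≡ : ∀ {k} (k<n : k < n) → position k ≡ toℕ (x ⟨$⟩ˡ fromℕ< k<n)
  position-≡ {k} k<n with k <? n
  ... | yes k<n′ = refl
  ... | no k≮n   = contradiction k<n k≮n

  position-< : ∀ {k} → k < n → position k < n
  position-< k<n = subst (_< n) (sym (position-≡ k<n)) (Fin.toℕ<n _)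

  position-at : ∀ i → position (toℕ (x ⟨$⟩ʳ i)) ≡ toℕ i
  position-at i = trans (position-≡ (Fin.toℕ<n (x ⟨$⟩ʳ i)))
    (cong toℕ (trans (cong (x ⟨$⟩ˡ_) (Fin.fromℕ<-toℕ _ _)) (inverseˡ x)))

  position-injective : ∀ {a b} → position a ≡ position b → a ≡ b
  position-injective {a} {b} eq with a <? n | b <? n
  ... | yes a<n | yes b<n = Fin.fromℕ<-injective a b a<n b<n (trans (sym (inverseʳ x))
                              (trans (cong (x ⟨$⟩ʳ_) (Fin.toℕ-injective eq)) (inverseʳ x)))
  ... | yes a<n | no b≮n  = contradiction (subst (_< n) eq (Fin.toℕ<n _)) b≮n
  ... | no a≮n  | yes b<n = contradiction (subst (_< n) (sym eq) (Fin.toℕ<n _)) a≮n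
  ... | no _    | no _    = eq

  private
    _⊏_ : Rel ℕ 0ℓ
    _⊏_ = Precedes position

    sto : IsStrictTotalOrder _≡_ _⊏_
    sto = Precedes-isStrictTotalOrder position-injective

  ρ-drawn : Drawn n position n (ρ x)
  ρ-drawn = Drawn-foldl position-injective (x ⟨$⟩ʳ_) position-at Drawn-[]

  module _ (τ : Tiling n) where
    open Tiling τ

    -- The order alone determines the sides of every tile. This serves both the tiling read off from
    -- `ρ x` and a tiling given in advance of which `x` is a linear extension.
    ρ-represented-by : (∀ {k} → k < n → IsTile _⊏_ n k (L k) (R k) (T k) (B k)) → Represents τ (ρ x)
    ρ-represented-by isTile = record
      { box∈ = λ k<n → let r , r∈ρ , t = tile-of k<n (position-< k<n)
                       in subst (_∈ ρ x) (≡box k<n t) r∈ρ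
      ; ∈box = λ r∈ρ → let k , (k<n , _) , t = is-a-tile r∈ρ in k , k<n , ≡box k<n t
      }
      where
      open Drawn ρ-drawn
      ≡box : ∀ {k r} → k < n → IsTileRect _⊏_ n k r → r ≡ box k
      ≡box {k} {rect l b r t} k<n tileRect with IsTile-unique sto (IsTileRect.isTile tileRect) (isTile k<n)
      ... | (refl , refl) , (t≡ , b≡) = cong₂ (λ b t → rect l b r t) (unflip bottom≤ b≡) (unflip top≤ t≡)
        where
        open IsTileRect tileRect using (top≤; bottom≤)
        unflip : ∀ {a c} → a ≤ n → n ∸ a ≡ c → a ≡ n ∸ c
        unflip a≤n n∸a≡c = trans (sym (m∸[m∸n]≡n a≤n)) (cong (n ∸_) n∸a≡c)

  ρ-tiling : Σ[ τ ∈ Tiling n ] (let open Tiling τ in ∀ {k} → k < n → IsTile _⊏_ n k (L k) (R k) (T k) (B k))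
  ρ-tiling = tiling sto (left ∘ f) (right ∘ f) (λ k → n ∸ top (f k)) (λ k → n ∸ bottom (f k)) isTile , isTile
    where
    chosen = choose {n} (rect 0 0 0 0) λ k k<n → map₂ proj₂ (Drawn.tile-of ρ-drawn k<n (position-< k<n))
    f = proj₁ chosen
    isTile : ∀ {k} → k < n → IsTile _⊏_ n k (left (f k)) (right (f k)) (n ∸ top (f k)) (n ∸ bottom (f k))
    isTile k<n = IsTileRect.isTile (proj₂ chosen k<n)

-- Walls as maximal runs of unit edges

lower-exists : ∀ {Q} → Decidable Q → ∀ k → ∃ (IsLower Q k)
lower-exists Q? zero = zero , record { below = z≤n ; inside = λ _ () ; stop = λ () }
lower-exists {Q} Q? (suc k) with Q? k
... | no ¬q = suc k , record
  { below = ≤-refl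
  ; inside = λ k<m m≤k → contradiction k<m (≤⇒≯ (s≤s⁻¹ m≤k))
  ; stop = λ k+1≡m+1 q → ¬q (subst Q (suc-injective (sym k+1≡m+1)) q) }
... | yes q with lower-exists Q? k
...   | l , isLower = l , record { below = m≤n⇒m≤1+n below ; inside = inside′ ; stop = stop }
  where
  open IsLower isLower
  inside′ : ∀ {m} → l ≤ m → m < suc k → Q m
  inside′ l≤m m≤k with m≤n⇒m<n∨m≡n (s≤s⁻¹ m≤k)
  ... | inj₁ m<k  = inside l≤m m<k
  ... | inj₂ refl = q

upper-exists : ∀ {Q} → Decidable Q → ∀ {n k} → k < n → ∃ (IsUpper Q n k)
upper-exists Q? {suc n} {k} k<n+1 with m≤n⇒m<n∨m≡n (s≤s⁻¹ k<n+1)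
... | inj₂ refl = suc n , record
  { above = ≤-refl ; bound = ≤-refl
  ; inside = λ n<m m≤n → contradiction n<m (≤⇒≯ (s≤s⁻¹ m≤n))
  ; stop = λ n+1<n+1 → contradiction n+1<n+1 (<-irrefl refl) }
upper-exists {Q} Q? {suc n} {k} _ | inj₁ k<n with upper-exists Q? k<n
... | r , isUpper with m≤n⇒m<n∨m≡n (IsUpper.bound isUpper)
...   | inj₁ r<n = r , record { above = above ; bound = m≤n⇒m≤1+n bound ; inside = inside ; stop = λ _ → stop r<n }
  where open IsUpper isUpper
...   | inj₂ refl with Q? n
...     | no ¬q = n , record { above = above ; bound = n≤1+n n ; inside = inside ; stop = λ _ → ¬q }
  where open IsUpper isUpper
...     | yes q = suc n , record
  { above = k<n+1 ; bound = ≤-refl ; inside = inside′ ; stop = λ n+1<n+1 → contradiction n+1<n+1 (<-irrefl refl) }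
  where
  open IsUpper isUpper
  k<n+1 = m≤n⇒m≤1+n above
  inside′ : ∀ {m} → k < m → m < suc n → Q m
  inside′ k<m m≤n with m≤n⇒m<n∨m≡n (s≤s⁻¹ m≤n)
  ... | inj₁ m<n  = inside k<m m<n
  ... | inj₂ refl = q

record MaximalRun (E : ℕ → Set) (a b : ℕ) : Set where
  field
    nonempty : a < b
    inside   : ∀ {i} → a ≤ i → i < b → E i
    stop-low : ∀ {i} → a ≡ suc i → ¬ E i
    stop-up  : ¬ E b

  extend-low : ∀ {k m} → a ≤ m → (∀ {i} → k ≤ i → i ≤ m → E i) → a ≤ k
  extend-low {k} {m} a≤m e = ≮⇒≥ λ k<a → extend a refl k<a
    where
    extend : ∀ a′ → a ≡ a′ → ¬ k < a′
    extend (suc i) a≡i+1 (s≤s k≤i) = stop-low a≡i+1 (e k≤i (<⇒≤ (subst (_≤ m) a≡i+1 a≤m)))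

  extend-up : ∀ {k m} → m < b → (∀ {i} → m ≤ i → i ≤ k → E i) → k < b
  extend-up m<b e = ≰⇒> λ b≤k → stop-up (e (<⇒≤ m<b) b≤k)

MaximalRun-unique : ∀ {E a b a′ b′ m} → MaximalRun E a b → MaximalRun E a′ b′ →
                    a ≤ m → m < b → a′ ≤ m → m < b′ → a ≡ a′ × b ≡ b′
MaximalRun-unique r s a≤m m<b a′≤m m<b′ =
  ≤-antisym (low r s a≤m a′≤m m<b′) (low s r a′≤m a≤m m<b) ,
  ≤-antisym (up s r m<b′ a≤m) (up r s m<b a′≤m)
  where
  open MaximalRun
  low : ∀ {E a b a′ b′ m} → MaximalRun E a b → MaximalRun E a′ b′ → a ≤ m → a′ ≤ m → m < b′ → a ≤ a′
  low r s a≤m a′≤m m<b′ = extend-low r a≤m λ a′≤i i≤m → inside s a′≤i (≤-<-trans i≤m m<b′)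
  up : ∀ {E a b a′ b′ m} → MaximalRun E a b → MaximalRun E a′ b′ → m < b → a′ ≤ m → b′ ≤ b
  up {b = b} r s m<b a′≤m = ≮⇒≥ λ b<b′ → <-irrefl refl
    (extend-up r m<b λ m≤i i≤b → inside s (≤-trans a′≤m m≤i) (≤-<-trans i≤b b<b′))

maximalRun : ∀ {E n m} → Decidable E → (∀ {i} → E i → i < n) → E m →
             ∃[ a ] ∃[ b ] (a ≤ m × m < b) × MaximalRun E a b
maximalRun {E} {n} {m} E? bounded e =
  let a , isLower = lower-exists E? m
      b , isUpper = upper-exists E? (bounded e)
      module A = IsLower isLower
      module B = IsUpper isUpper
      inside : ∀ {i} → a ≤ i → i < b → E i
      inside {i} a≤i i<b = case <-cmp i m of λ where
        (tri< i<m _ _)  → A.inside a≤i i<m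
        (tri≈ _ refl _) → e
        (tri> _ _ m<i)  → B.inside m<i i<b
  in a , b , (A.below , B.above) , record
    { nonempty = ≤-<-trans A.below B.above
    ; inside   = inside
    ; stop-low = A.stop
    ; stop-up  = λ eb → B.stop (bounded eb) eb
    }

data Axis : Set where
  horizontal vertical : Axis

segment : Axis → ℕ → ℕ → ℕ → Segment
segment horizontal = hseg
segment vertical   = vseg

point : Axis → ℕ → ℕ → Point
point horizontal c p = p , c
point vertical   c p = c , p

Edge : List Rect → Axis → ℕ → ℕ → Set
Edge Rs horizontal c i = Any (HEdgeOnBoundary i c) Rs
Edge Rs vertical   c i = Any (VEdgeOnBoundary c i) Rs

edge? : ∀ Rs o c → Decidable (Edge Rs o c)
edge? Rs horizontal c i = any? (λ r → ((left r ≤? i) ×-dec (i <? right r)) ×-dec ((c ≟ bottom r) ⊎-dec (c ≟ top r))) Rs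
edge? Rs vertical   c i = any? (λ r → ((bottom r ≤? i) ×-dec (i <? top r)) ×-dec ((c ≟ left r) ⊎-dec (c ≟ right r))) Rs

data SegmentView : Segment → Set where
  along : ∀ o c a b → SegmentView (segment o c a b)

segmentView : ∀ s → SegmentView s
segmentView (hseg y a b) = along horizontal y a b
segmentView (vseg x a b) = along vertical x a b

nondegenerate⇒ : ∀ o {c a b} → Nondegenerate (segment o c a b) → a < b
nondegenerate⇒ horizontal a<b = a<b
nondegenerate⇒ vertical   a<b = a<b

⇒nondegenerate : ∀ o {c a b} → a < b → Nondegenerate (segment o c a b)
⇒nondegenerate horizontal a<b = a<b
⇒nondegenerate vertical   a<b = a<b

inBoundaries⇒ : ∀ {Rs} o {c a b} → InBoundaries Rs (segment o c a b) → ∀ {i} → a ≤ i → i < b → Edge Rs o c i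
inBoundaries⇒ horizontal e = e _
inBoundaries⇒ vertical   e = e _

⇒inBoundaries : ∀ {Rs} o {c a b} → (∀ {i} → a ≤ i → i < b → Edge Rs o c i) → InBoundaries Rs (segment o c a b)
⇒inBoundaries horizontal e _ = e
⇒inBoundaries vertical   e _ = e

⊆-segment : ∀ o {c a b a′ b′} → a′ ≤ a → b ≤ b′ → segment o c a b ⊆ˢ segment o c a′ b′
⊆-segment horizontal a′≤a b≤b′ _ (c , a≤p , p≤b) = c , ≤-trans a′≤a a≤p , ≤-trans p≤b b≤b′
⊆-segment vertical   a′≤a b≤b′ _ (c , a≤p , p≤b) = c , ≤-trans a′≤a a≤p , ≤-trans p≤b b≤b′

endpoints∈ : ∀ o {c a b} → a < b → point o c a ∈ˢ segment o c a b × point o c b ∈ˢ segment o c a b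
endpoints∈ horizontal a<b = (refl , ≤-refl , <⇒≤ a<b) , (refl , <⇒≤ a<b , ≤-refl)
endpoints∈ vertical   a<b = (refl , ≤-refl , <⇒≤ a<b) , (refl , <⇒≤ a<b , ≤-refl)

⊆-same-line : ∀ o o′ {c c′ a b a′ b′} → a < b → segment o c a b ⊆ˢ segment o′ c′ a′ b′ →
              o ≡ o′ × c ≡ c′ × a′ ≤ a × b ≤ b′
⊆-same-line horizontal horizontal a<b s⊆t with endpoints∈ horizontal a<b
... | a∈ , b∈ = let c , a′≤a , _ = s⊆t _ a∈ ; _ , _ , b≤b′ = s⊆t _ b∈ in refl , c , a′≤a , b≤b′
⊆-same-line vertical   vertical   a<b s⊆t with endpoints∈ vertical a<b
... | a∈ , b∈ = let c , a′≤a , _ = s⊆t _ a∈ ; _ , _ , b≤b′ = s⊆t _ b∈ in refl , c , a′≤a , b≤b′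
⊆-same-line horizontal vertical   a<b s⊆t with endpoints∈ horizontal a<b
... | a∈ , b∈ = contradiction (trans (proj₁ (s⊆t _ a∈)) (sym (proj₁ (s⊆t _ b∈)))) (<⇒≢ a<b)
⊆-same-line vertical   horizontal a<b s⊆t with endpoints∈ vertical a<b
... | a∈ , b∈ = contradiction (trans (proj₁ (s⊆t _ a∈)) (sym (proj₁ (s⊆t _ b∈)))) (<⇒≢ a<b)

segment-injective : ∀ o {c c′ a b a′ b′} → segment o c a b ≡ segment o c′ a′ b′ → a ≡ a′ × b ≡ b′
segment-injective horizontal refl = refl , refl
segment-injective vertical   refl = refl , refl

maximal⇒run : ∀ {Rs} o {c a b} → IsMaximalSegment Rs (segment o c a b) → MaximalRun (Edge Rs o c) a b
maximal⇒run {Rs} o {c} {a} {b} (nondegenerate , inB , maximal) = record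
  { nonempty = a<b ; inside = inside ; stop-low = stop-low ; stop-up = stop-up }
  where
  a<b = nondegenerate⇒ o nondegenerate
  inside : ∀ {i} → a ≤ i → i < b → Edge Rs o c i
  inside = inBoundaries⇒ o inB
  stop-low : ∀ {i} → a ≡ suc i → ¬ Edge Rs o c i
  stop-low {i} refl e = <⇒≢ (n<1+n i) (proj₁ (segment-injective o (maximal (segment o c i b)
    (⇒nondegenerate o (<-trans (n<1+n i) a<b)) (⇒inBoundaries o inside′) (⊆-segment o (n≤1+n i) ≤-refl))))
    where
    inside′ : ∀ {j} → i ≤ j → j < b → Edge Rs o c j
    inside′ i≤j j<b with m≤n⇒m<n∨m≡n i≤j
    ... | inj₁ i<j  = inside i<j j<b
    ... | inj₂ refl = e
  stop-up : ¬ Edge Rs o c b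
  stop-up e = >⇒≢ (n<1+n b) (proj₂ (segment-injective o (maximal (segment o c a (suc b))
    (⇒nondegenerate o (m≤n⇒m≤1+n a<b)) (⇒inBoundaries o inside′) (⊆-segment o ≤-refl (n≤1+n b)))))
    where
    inside′ : ∀ {j} → a ≤ j → j < suc b → Edge Rs o c j
    inside′ a≤j j≤b with m≤n⇒m<n∨m≡n (s≤s⁻¹ j≤b)
    ... | inj₁ j<b  = inside a≤j j<b
    ... | inj₂ refl = e

run⇒maximal : ∀ {Rs} o {c a b} → MaximalRun (Edge Rs o c) a b → IsMaximalSegment Rs (segment o c a b)
run⇒maximal {Rs} o {c} {a} {b} run = ⇒nondegenerate o nonempty , ⇒inBoundaries o inside , maximal
  where
  open MaximalRun run
  maximal : ∀ t → Nondegenerate t → InBoundaries Rs t → segment o c a b ⊆ˢ t → t ≡ segment o c a b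
  maximal t nondegenerate inB s⊆t with segmentView t
  ... | along o′ c′ a′ b′ with ⊆-same-line o o′ nonempty s⊆t
  ...   | refl , refl , a′≤a , b≤b′ = cong₂ (segment o c)
    (≤-antisym a′≤a (extend-low ≤-refl λ a′≤i i≤a → inside′ a′≤i (≤-<-trans i≤a a<b′)))
    (≤-antisym (≮⇒≥ λ b<b′ → stop-up (inside′ (≤-trans a′≤a (<⇒≤ nonempty)) b<b′)) b≤b′)
    where
    a<b′ = <-≤-trans nonempty b≤b′
    inside′ : ∀ {i} → a′ ≤ i → i < b′ → Edge Rs o c i
    inside′ = inBoundaries⇒ o inB

edge⇒wall : ∀ {n Rs} o {c m} → (∀ {i} → Edge Rs o c i → i < n) → 0 < c → c < n → Edge Rs o c m →
            ∃[ a ] ∃[ b ] (a ≤ m × m < b) × IsWall n Rs (segment o c a b)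
edge⇒wall {n} {Rs} o {c} bounded 0<c c<n e with maximalRun (edge? Rs o c) bounded e
... | a , b , m∈ , run = a , b , m∈ , run⇒maximal o run , not-edge o
  where
  not-edge : ∀ o → segment o c a b ∉ edges n
  not-edge horizontal (here refl) = <-irrefl refl 0<c
  not-edge horizontal (there (here refl)) = <-irrefl refl c<n
  not-edge horizontal (there (there (here ())))
  not-edge horizontal (there (there (there (here ()))))
  not-edge vertical (there (there (here refl))) = <-irrefl refl 0<c
  not-edge vertical (there (there (there (here refl)))) = <-irrefl refl c<n
  not-edge vertical (here ())
  not-edge vertical (there (here ()))

-- From tilings to diagonal rectangulations

suc-∸-suc : ∀ {n y} → y < n → suc (n ∸ suc y) ≡ n ∸ y
suc-∸-suc {suc n} {zero}  _         = refl
suc-∸-suc {suc n} {suc y} (s≤s y<n) = suc-∸-suc y<n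

∸-suc-∸-suc : ∀ {n y} → y < n → n ∸ suc (n ∸ suc y) ≡ y
∸-suc-∸-suc {n} y<n = trans (cong (n ∸_) (suc-∸-suc y<n)) (m∸[m∸n]≡n (<⇒≤ y<n))

∸-suc-< : ∀ {n y} → y < n → n ∸ suc y < n
∸-suc-< {suc n} {y} _ = s≤s (m∸n≤m n y)

rows⇒ : ∀ {n y t b} → y < n → b ≤ n → t ≤ n → n ∸ b ≤ y × y < n ∸ t → t ≤ n ∸ suc y × n ∸ suc y < b
rows⇒ {n} {y} {t} {b} y<n b≤n t≤n (b≤ , <t) =
  ∸-flip-≤ t≤n <t , subst (_≤ b) (sym (suc-∸-suc y<n)) (∸-flip-≥ b≤n b≤)

⇒rows : ∀ {n y t b} → y < n → t ≤ n ∸ suc y × n ∸ suc y < b → n ∸ b ≤ y × y < n ∸ t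
⇒rows {n} {y} {t} {b} y<n (t≤ , <b) =
  ∸-flip-≥ (<⇒≤ y<n) (subst (_≤ b) (suc-∸-suc y<n) <b) , ∸-flip-≤ y<n t≤

module _ {n} (τ : Tiling n) where
  open Tiling τ
  open Tiling (transpose τ) using () renaming (VEdge to HEdge)

  private
    T≤n : ∀ {k} → k < n → T k ≤ n
    T≤n k<n = ≤-trans (T≤ k<n) (<⇒≤ k<n)

  cell⇒covers : ∀ {k i y} → k < n → y < n → CellIn i y (box k) → Covers k i (n ∸ suc y)
  cell⇒covers k<n y<n (cols , rows) = cols , rows⇒ y<n (B≤ k<n) (T≤n k<n) rows

  covers⇒cell : ∀ {k i y} → k < n → y < n → Covers k i (n ∸ suc y) → CellIn i y (box k)
  covers⇒cell k<n y<n (cols , rows) = cols , ⇒rows y<n rows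

  isRectIn : ∀ {k} → k < n → IsRectIn n (box k)
  isRectIn {k} k<n = (≤-<-trans (L≤ k<n) (<R k<n) , R≤ k<n) ,
                     (∸-monoʳ-< (≤-<-trans (T≤ k<n) (<B k<n)) (B≤ k<n) , m∸n≤m n (T k))

  -- The side found by `vedge-classify` runs from row j to the diagonal cell of its tile, which is
  -- beyond the diagonal point. So rows w and w + 1 are both included, and the point is interior to
  -- the wall.
  VEdge-next-to-diagonal : ∀ {w j} → suc w < n → VEdge (suc w) j →
    ∀ {i} → (w ≤ i × i ≤ j) ⊎ (j ≤ i × i ≤ suc w) → VEdge (suc w) i
  VEdge-next-to-diagonal {w} {j} w+1<n e {i} between with vedge-classify τ w+1<n e
  ... | inj₁ (w<j , R≡ , j<B) = w , w<n , [ ok , ok ∘ (λ { (j≤i , i≤w+1) →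
          ≤-trans (<⇒≤ w<j) j≤i , ≤-trans i≤w+1 w<j }) ]′ between , inj₂ (sym R≡)
    where
    w<n = <-trans (n<1+n w) w+1<n
    ok : w ≤ i × i ≤ j → T w ≤ i × i < B w
    ok (w≤i , i≤j) = ≤-trans (T≤ w<n) w≤i , ≤-<-trans i≤j j<B
  ... | inj₂ (j≤w , L≡ , T≤j) = suc w , w+1<n , [ ok ∘ (λ { (w≤i , i≤j) →
          ≤-trans j≤w w≤i , ≤-trans i≤j (m≤n⇒m≤1+n j≤w) }) , ok ]′ between , inj₁ (sym L≡)
    where
    ok : j ≤ i × i ≤ suc w → T (suc w) ≤ i × i < B (suc w)
    ok (j≤i , i≤w+1) = ≤-trans T≤j j≤i , ≤-<-trans i≤w+1 (<B w+1<n)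

  -- The cell (w , w + 1) touches the diagonal point and belongs to tile w or tile w + 1. As neither
  -- tile contains both diagonal cells, the first has its right side at the point, or the second its
  -- upper side.
  edge-at-diagonal : ∀ {w} → suc w < n → VEdge (suc w) w ⊎ HEdge (suc w) w
  edge-at-diagonal {w} w+1<n with cover (<-trans (n<1+n w) w+1<n) w+1<n
  ... | k , k<n , c@((L≤w , w<R) , (T≤w+1 , w+1<B)) with covers-between (n≤1+n w) w+1<n k<n c
  ...   | w≤k , k≤w+1 with m≤n⇒m<n∨m≡n w≤k
  ...     | inj₂ refl = inj₁ (w , k<n , (T≤ k<n , <B k<n) , inj₂ (≤-antisym (<R k<n)
    (≮⇒≥ λ w+1<R → <⇒≢ (n<1+n w) (disjoint k<n w+1<n ((m≤n⇒m≤1+n L≤w , w+1<R) , (T≤w+1 , w+1<B))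
                                      (covers-diagonal w+1<n)))))
  ...     | inj₁ w<k with refl ← ≤-antisym k≤w+1 w<k = inj₂ (suc w , k<n , (L≤w , w<R) , inj₁ (≤-antisym
    (≮⇒≥ λ T<w+1 → <⇒≢ (n<1+n w) (disjoint w<n k<n (covers-diagonal w<n)
                                      ((L≤w , w<R) , (s≤s⁻¹ T<w+1 , <-trans (n<1+n w) (<B k<n)))))
    (T≤ k<n)))
    where w<n = <-trans (n<1+n w) w+1<n

  VEdge-left : ∀ {j} → j < n → VEdge 0 j
  VEdge-left j<n with cover (≤-<-trans z≤n j<n) j<n
  ... | k , k<n , (L≤0 , _) , rows = k , k<n , rows , inj₁ (sym (n≤0⇒n≡0 L≤0))

  VEdge-right : ∀ {j} → j < n → VEdge n j
  VEdge-right {j} j<n = at n refl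
    where
    at : ∀ m → m ≡ n → VEdge n j
    at zero refl = contradiction j<n λ ()
    at (suc m) refl with cover {m} ≤-refl j<n
    ... | k , k<n , (_ , m<R) , rows = k , k<n , rows , inj₂ (≤-antisym m<R (R≤ k<n))

  VEdge-≤ : ∀ {x j} → VEdge x j → x ≤ n
  VEdge-≤ (k , k<n , _ , inj₁ refl) = ≤-trans (L≤ k<n) (<⇒≤ k<n)
  VEdge-≤ (k , k<n , _ , inj₂ refl) = R≤ k<n

module _ {n Rs} {τ : Tiling n} (represents : Represents τ Rs) where
  open Represents represents
  open Tiling τ
  private
    module τᵀ = Tiling (transpose τ)
  open Tiling (transpose τ) using () renaming (VEdge to HEdge)

  vertical⇒ : ∀ {x y} → Edge Rs vertical x y → y < n × VEdge x (n ∸ suc y)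
  vertical⇒ e with find e
  ... | r , r∈Rs , (b≤y , y<t) , side with ∈box r∈Rs
  ...   | k , k<n , refl = y<n , k , k<n , rows⇒ y<n (B≤ k<n) (≤-trans (T≤ k<n) (<⇒≤ k<n)) (b≤y , y<t) , side
    where y<n = <-≤-trans y<t (m∸n≤m n (T k))

  ⇒vertical : ∀ {x y} → y < n → VEdge x (n ∸ suc y) → Edge Rs vertical x y
  ⇒vertical y<n (k , k<n , rows , side) = lose (box∈ k<n) (⇒rows y<n rows , side)

  horizontal⇒ : ∀ {y i} → Edge Rs horizontal y i → (y ≤ n × i < n) × HEdge (n ∸ y) i
  horizontal⇒ {y} e with find e
  ... | r , r∈Rs , (l≤i , i<r) , side with ∈box r∈Rs
  ...   | k , k<n , refl = ([ y≤n {B k} , y≤n {T k} ]′ side , <-≤-trans i<r (R≤ k<n)) , k , k<n , (l≤i , i<r) ,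
          Sum.swap (Sum.map (flip-≡ (B≤ k<n)) (flip-≡ (≤-trans (T≤ k<n) (<⇒≤ k<n))) side)
    where
    y≤n : ∀ {a} → y ≡ n ∸ a → y ≤ n
    y≤n {a} refl = m∸n≤m n a
    flip-≡ : ∀ {a} → a ≤ n → y ≡ n ∸ a → n ∸ y ≡ a
    flip-≡ a≤n refl = m∸[m∸n]≡n a≤n

  ⇒horizontal : ∀ {y i} → y ≤ n → HEdge (n ∸ y) i → Edge Rs horizontal y i
  ⇒horizontal {y} y≤n (k , k<n , cols , side) = lose (box∈ k<n) (cols , Sum.swap (Sum.map flip-≡ flip-≡ side))
    where
    flip-≡ : ∀ {a} → n ∸ y ≡ a → y ≡ n ∸ a
    flip-≡ refl = sym (m∸[m∸n]≡n y≤n)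

  edge-< : ∀ o {c i} → Edge Rs o c i → i < n
  edge-< horizontal e = proj₂ (proj₁ (horizontal⇒ e))
  edge-< vertical   e = proj₁ (vertical⇒ e)

  -- The lines through the diagonal point p = (w + 1 , n - (w + 1)) and, on
  -- each of them, the unit edge that ends at p coming from smaller coordinates.
  line : Axis → ℕ → ℕ
  line horizontal w = n ∸ suc w
  line vertical   w = suc w

  before-diagonal : Axis → ℕ → ℕ
  before-diagonal horizontal w = w
  before-diagonal vertical   w = n ∸ suc (suc w)

  -- Heights run against row numbers, so the two alternatives keep their order for vertical lines
  -- and are swapped for horizontal ones.
  edge-next-to-diagonal : ∀ o {w m} → suc w < n → Edge Rs o (line o w) m →
    let q = before-diagonal o w in
    ∀ {i} → (m ≤ i × i ≤ suc q) ⊎ (q ≤ i × i ≤ m) → Edge Rs o (line o w) i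
  edge-next-to-diagonal horizontal {w} {m} w+1<n e {i} between =
    ⇒horizontal (m∸n≤m n (suc w)) (subst (λ j → HEdge j i) (sym w≡)
      (VEdge-next-to-diagonal (transpose τ) w+1<n (subst (λ j → HEdge j m) w≡ (proj₂ (horizontal⇒ e)))
        (Sum.swap between)))
    where
    w≡ : n ∸ (n ∸ suc w) ≡ suc w
    w≡ = m∸[m∸n]≡n (<⇒≤ w+1<n)
  edge-next-to-diagonal vertical {w} {m} w+1<n e {i} between =
    ⇒vertical i<n (VEdge-next-to-diagonal τ w+1<n (proj₂ (vertical⇒ e)) (Sum.map below above between))
    where
    m<n = proj₁ (vertical⇒ e)
    w+1≡ : suc (n ∸ suc (suc w)) ≡ n ∸ suc w
    w+1≡ = suc-∸-suc w+1<n
    q+1<n : suc (n ∸ suc (suc w)) < n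
    q+1<n = subst (_< n) (sym w+1≡) (∸-suc-< (<-trans (n<1+n w) w+1<n))
    i<n : i < n
    i<n = [ (λ { (_ , i≤q+1) → ≤-<-trans i≤q+1 q+1<n }) , (λ { (_ , i≤m) → ≤-<-trans i≤m m<n }) ]′ between
    below : m ≤ i × i ≤ suc (n ∸ suc (suc w)) → w ≤ n ∸ suc i × n ∸ suc i ≤ n ∸ suc m
    below (m≤i , i≤q+1) =
      s≤s⁻¹ (subst (suc w ≤_) (sym (suc-∸-suc i<n)) (∸-flip-≤ (<⇒≤ w+1<n) (subst (i ≤_) w+1≡ i≤q+1))) ,
      ∸-monoʳ-≤ n (s≤s m≤i)
    above : n ∸ suc (suc w) ≤ i × i ≤ m → n ∸ suc m ≤ n ∸ suc i × n ∸ suc i ≤ suc w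
    above (q≤i , i≤m) = ∸-monoʳ-≤ n (s≤s i≤m) ,
      s≤s⁻¹ (subst (_≤ suc (suc w)) (sym (suc-∸-suc i<n)) (∸-flip-≥ w+1<n q≤i))

  Run : Axis → ℕ → ℕ → ℕ → Set
  Run o w = MaximalRun (Edge Rs o (line o w))

  run-through-diagonal : ∀ o {w a b} → suc w < n → Run o w a b →
                         a ≤ before-diagonal o w × suc (before-diagonal o w) < b
  run-through-diagonal o {w} {a} w+1<n run =
    extend-low ≤-refl (λ q≤i i≤a → next (inj₂ (q≤i , i≤a))) ,
    extend-up nonempty λ a≤i i≤q+1 → next (inj₁ (a≤i , i≤q+1))
    where
    open MaximalRun run
    next : ∀ {i} → _ → Edge Rs o (line o w) i
    next = edge-next-to-diagonal o w+1<n (inside ≤-refl nonempty)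

  diagonal∈segment : ∀ o {w a b} → suc w < n → Run o w a b → (suc w , n ∸ suc w) ∈ˢ segment o (line o w) a b
  diagonal∈segment horizontal w+1<n run =
    let a≤q , q+1<b = run-through-diagonal horizontal w+1<n run
    in refl , m≤n⇒m≤1+n a≤q , <⇒≤ q+1<b
  diagonal∈segment vertical {w} {a} {b} w+1<n run =
    let a≤q , q+1<b = run-through-diagonal vertical w+1<n run
    in refl , subst (a ≤_) (suc-∸-suc w+1<n) (m≤n⇒m≤1+n a≤q) , subst (_≤ b) (suc-∸-suc w+1<n) (<⇒≤ q+1<b)

  data WallView : Segment → Set where
    wall : ∀ o w {a b} → suc w < n → Run o w a b → WallView (segment o (line o w) a b)

  boundary-run : ∀ {o c a b} → (∀ {i} → i < n → Edge Rs o c i) → MaximalRun (Edge Rs o c) a b → a ≡ 0 × b ≡ n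
  boundary-run {o} {c} {a} {b} e run = n≤0⇒n≡0 (extend-low ≤-refl λ _ i≤a → e (≤-<-trans i≤a (<-≤-trans nonempty b≤n))) ,
                           ≤-antisym b≤n (≮⇒≥ λ b<n → stop-up (e b<n))
    where
    open MaximalRun run
    b≤n : b ≤ n
    b≤n = last b refl
      where
      last : ∀ b′ → b ≡ b′ → b′ ≤ n
      last zero     _     = z≤n
      last (suc b′) refl = edge-< o (inside (s≤s⁻¹ nonempty) ≤-refl)

  -- On the line of an edge of S every unit edge is present, so a maximal run there is the whole
  -- edge and not a wall.
  wallView : ∀ s → IsWall n Rs s → WallView s
  wallView s (maximal , ∉edges) with segmentView s
  ... | along vertical x a b = view x refl
    where
    run = maximal⇒run vertical maximal
    open MaximalRun run
    view : ∀ x′ → x ≡ x′ → WallView (vseg x a b)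
    view zero refl with boundary-run {vertical} (λ i<n → ⇒vertical i<n (VEdge-left τ (∸-suc-< i<n))) run
    ... | refl , refl = contradiction (there (there (here refl))) ∉edges
    view (suc w) refl with m≤n⇒m<n∨m≡n (VEdge-≤ τ (proj₂ (vertical⇒ (inside ≤-refl nonempty))))
    ... | inj₁ w+1<n = wall vertical w w+1<n run
    ... | inj₂ refl with boundary-run {vertical} (λ i<n → ⇒vertical i<n (VEdge-right τ (∸-suc-< i<n))) run
    ...   | refl , refl = contradiction (there (there (there (here refl)))) ∉edges
  ... | along horizontal y a b = view (n ∸ y) refl
    where
    run = maximal⇒run horizontal maximal
    open MaximalRun run
    y≤n = proj₁ (proj₁ (horizontal⇒ (inside ≤-refl nonempty)))
    view : ∀ y′ → n ∸ y ≡ y′ → WallView (hseg y a b)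
    view zero n∸y≡0 with ≤-antisym y≤n (m∸n≡0⇒m≤n n∸y≡0)
    ... | refl with boundary-run {horizontal} (λ {i} i<n → ⇒horizontal ≤-refl (subst (λ j → HEdge j i) (sym (n∸n≡0 n))
                                                      (VEdge-left (transpose τ) i<n))) run
    ...   | refl , refl = contradiction (there (here refl)) ∉edges
    view (suc w) n∸y≡w+1 with m≤n⇒m<n∨m≡n (subst (_≤ n) n∸y≡w+1 (m∸n≤m n y))
    ... | inj₁ w+1<n = subst (λ y → WallView (hseg y a b)) (sym y≡)
        (wall horizontal w w+1<n (subst (λ y → MaximalRun (Edge Rs horizontal y) a b) y≡ run))
      where
      y≡ : y ≡ n ∸ suc w
      y≡ = trans (sym (m∸[m∸n]≡n y≤n)) (cong (n ∸_) n∸y≡w+1)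
    ... | inj₂ w+1≡n with trans (sym (m∸[m∸n]≡n y≤n)) (trans (cong (n ∸_) (trans n∸y≡w+1 w+1≡n)) (n∸n≡0 n))
    ...   | refl with boundary-run {horizontal} (λ i<n → ⇒horizontal z≤n (VEdge-right (transpose τ) i<n)) run
    ...     | refl , refl = contradiction (here refl) ∉edges

  run-unique : ∀ o {w a b a′ b′} → suc w < n → Run o w a b → Run o w a′ b′ →
               segment o (line o w) a b ≡ segment o (line o w) a′ b′
  run-unique o {w} w+1<n r s =
    let a≤q , q+1<b   = run-through-diagonal o w+1<n r
        a′≤q , q+1<b′ = run-through-diagonal o w+1<n s
        a≡ , b≡ = MaximalRun-unique r s a≤q (<-trans (n<1+n _) q+1<b) a′≤q (<-trans (n<1+n _) q+1<b′)
    in cong₂ (segment o (line o w)) a≡ b≡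

  crossing : ∀ {w v a b c d px py} → suc w < n → suc v < n → Run vertical w a b → Run horizontal v c d →
             InteriorPoint (px , py) (vseg (suc w) a b) → ¬ InteriorPoint (px , py) (hseg (n ∸ suc v) c d)
  crossing {w} {v} {a} {b} {c} {d} {px} {py} w+1<n v+1<n r s (px≡ , a<py , py<b) (py≡ , c<px , px<d) =
    no-crossing τ w+1<n v+1<n above below left-edge right-edge
    where
    module r = MaximalRun r
    module s = MaximalRun s
    v<n = <-trans (n<1+n v) v+1<n
    hedge : ∀ {i} → c ≤ i → i < d → HEdge (suc v) i
    hedge {i} c≤i i<d = subst (λ j → HEdge j i) (m∸[m∸n]≡n (<⇒≤ v+1<n)) (proj₂ (horizontal⇒ (s.inside c≤i i<d)))
    vedge : ∀ {y} → a ≤ y → y < b → VEdge (suc w) (n ∸ suc y)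
    vedge a≤y y<b = proj₂ (vertical⇒ (r.inside a≤y y<b))
    left-edge : HEdge (suc v) w
    left-edge = hedge (s≤s⁻¹ (subst (c <_) px≡ c<px)) (<-trans (n<1+n w) (subst (_< d) px≡ px<d))
    right-edge : HEdge (suc v) (suc w)
    right-edge = subst (HEdge (suc v)) px≡ (hedge (<⇒≤ c<px) px<d)
    above : VEdge (suc w) v
    above = subst (VEdge (suc w)) (trans (cong (λ y → n ∸ suc y) py≡) (∸-suc-∸-suc v<n)) (vedge (<⇒≤ a<py) py<b)
    q = n ∸ suc (suc v)
    py≡q+1 : py ≡ suc q
    py≡q+1 = trans py≡ (sym (suc-∸-suc v+1<n))
    below : VEdge (suc w) (suc v)
    below = subst (VEdge (suc w)) (∸-suc-∸-suc v+1<n)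
      (vedge (s≤s⁻¹ (subst (a <_) py≡q+1 a<py)) (<-trans (n<1+n q) (subst (_< b) py≡q+1 py<b)))

  wall-through-diagonal : ∀ o {w m} → suc w < n → Edge Rs o (line o w) m →
                          ∃[ s ] IsWall n Rs s × (suc w , n ∸ suc w) ∈ˢ s
  wall-through-diagonal o {w} w+1<n e with edge⇒wall o (edge-< o) (0<line o) (line<n o) e
    where
    0<line : ∀ o → 0 < line o w
    0<line horizontal = m<n⇒0<n∸m w+1<n
    0<line vertical   = z<s
    line<n : ∀ o → line o w < n
    line<n horizontal = ∸-suc-< (<-trans (n<1+n w) w+1<n)
    line<n vertical   = w+1<n
  ... | a , b , _ , is-wall = segment o (line o w) a b , is-wall ,
                              diagonal∈segment o w+1<n (maximal⇒run o (proj₁ is-wall))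

  represents⇒isDiagonalRectangulation : IsDiagonalRectangulation n Rs
  represents⇒isDiagonalRectangulation = record
    { subdivision  = All.tabulate (λ r∈Rs → in-square (∈box r∈Rs)) , cell
    ; noCrossing   = noCrossing
    ; wallHasPoint = wallHasPoint
    ; pointOnWall  = pointOnWall
    }
    where
    in-square : ∀ {r} → ∃[ k ] k < n × r ≡ box k → IsRectIn n r
    in-square (k , k<n , refl) = isRectIn τ k<n

    cell : ∀ i j → i < n → j < n → ∃! _≡_ λ r → r ∈ Rs × CellIn i j r
    cell i j i<n j<n with cover i<n (∸-suc-< j<n)
    ... | k , k<n , c = box k , (box∈ k<n , covers⇒cell τ k<n j<n c) , unique
      where
      unique : ∀ {r} → r ∈ Rs × CellIn i j r → box k ≡ r
      unique (r∈Rs , d) with ∈box r∈Rs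
      ... | m , m<n , refl = cong box (disjoint k<n m<n c (cell⇒covers τ m<n j<n d))

    noCrossing : ∀ s t → IsWall n Rs s → IsWall n Rs t → s ≢ t → ¬ (∃[ p ] InteriorPoint p s × InteriorPoint p t)
    noCrossing s t ws wt s≢t (p , p∈s , p∈t) with wallView s ws | wallView t wt
    ... | wall vertical w w+1<n r | wall horizontal v v+1<n r′ = crossing w+1<n v+1<n r r′ p∈s p∈t
    ... | wall horizontal v v+1<n r | wall vertical w w+1<n r′ = crossing w+1<n v+1<n r′ r p∈t p∈s
    ... | wall vertical w w+1<n r | wall vertical v _ r′ with trans (sym (proj₁ p∈s)) (proj₁ p∈t)
    ...   | refl = s≢t (run-unique vertical w+1<n r r′)
    noCrossing s t ws wt s≢t (p , p∈s , p∈t) | wall horizontal w w+1<n r | wall horizontal v v+1<n r′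
      with ∸-cancelˡ-≡ (<⇒≤ w+1<n) (<⇒≤ v+1<n) (trans (sym (proj₁ p∈s)) (proj₁ p∈t))
    ... | refl = s≢t (run-unique horizontal w+1<n r r′)

    wallHasPoint : ∀ s → IsWall n Rs s → ∃[ p ] InX n p × p ∈ˢ s
    wallHasPoint s ws with wallView s ws
    ... | wall o w w+1<n r = (suc w , n ∸ suc w) , (suc w , s≤s z≤n , w+1<n , refl) , diagonal∈segment o w+1<n r

    no-both : ∀ {w a b c d} → suc w < n → Run vertical w a b → ¬ Run horizontal w c d
    no-both {c = c} w+1<n r s = no-crossing-at-diagonal τ w+1<n
      (proj₂ (vertical⇒ (MaximalRun.inside r ≤-refl (MaximalRun.nonempty r))))
      (subst (λ j → HEdge j c) (m∸[m∸n]≡n (<⇒≤ w+1<n))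
        (proj₂ (horizontal⇒ (MaximalRun.inside s ≤-refl (MaximalRun.nonempty s)))))

    pointOnWall : ∀ p → InX n p → ∃! _≡_ λ s → IsWall n Rs s × p ∈ˢ s
    pointOnWall p (suc w , _ , w+1<n , refl) with existing
      where
      existing : ∃[ s ] IsWall n Rs s × (suc w , n ∸ suc w) ∈ˢ s
      existing with edge-at-diagonal τ w+1<n
      ... | inj₁ v = wall-through-diagonal vertical w+1<n (⇒vertical (∸-suc-< w<n) (subst (VEdge (suc w)) (sym (∸-suc-∸-suc w<n)) v))
        where w<n = <-trans (n<1+n w) w+1<n
      ... | inj₂ h = wall-through-diagonal horizontal w+1<n (⇒horizontal (m∸n≤m n (suc w))
                       (subst (λ j → HEdge j w) (sym (m∸[m∸n]≡n (<⇒≤ w+1<n))) h))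
    ... | s , ws , p∈s = s , (ws , p∈s) , unique
      where
      unique : ∀ {t} → IsWall n Rs t × (suc w , n ∸ suc w) ∈ˢ t → s ≡ t
      unique {t} (wt , p∈t) with wallView s ws | wallView t wt
      ... | wall vertical _ _ r | wall vertical _ _ r′ with refl ← proj₁ p∈s | refl ← proj₁ p∈t = run-unique vertical w+1<n r r′
      ... | wall horizontal u u<n r | wall horizontal v v<n r′
        with refl ← ∸-cancelˡ-≡ (<⇒≤ w+1<n) (<⇒≤ u<n) (proj₁ p∈s) | refl ← ∸-cancelˡ-≡ (<⇒≤ w+1<n) (<⇒≤ v<n) (proj₁ p∈t)
        = run-unique horizontal w+1<n r r′
      ... | wall vertical _ _ r | wall horizontal v v<n r′
        with refl ← proj₁ p∈s | refl ← ∸-cancelˡ-≡ (<⇒≤ w+1<n) (<⇒≤ v<n) (proj₁ p∈t) = contradiction r′ (no-both w+1<n r)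
      ... | wall horizontal u u<n r | wall vertical _ _ r′
        with refl ← ∸-cancelˡ-≡ (<⇒≤ w+1<n) (<⇒≤ u<n) (proj₁ p∈s) | refl ← proj₁ p∈t = contradiction r (no-both w+1<n r′)

-- The tiling of a diagonal rectangulation

module _ {n Rs} (isDR : IsDiagonalRectangulation n Rs) where
  open IsDiagonalRectangulation isDR

  private
    in-square : ∀ {r} → r ∈ Rs → IsRectIn n r
    in-square = All.lookup (proj₁ subdivision)

    same-cell : ∀ {r s i j} → r ∈ Rs → s ∈ Rs → CellIn i j r → CellIn i j s → r ≡ s
    same-cell {i = i} {j} r∈ s∈ c@((_ , i<) , (_ , j<)) d with in-square r∈
    ... | (_ , right≤n) , (_ , top≤n) with proj₂ subdivision i j (<-≤-trans i< right≤n) (<-≤-trans j< top≤n)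
    ...   | _ , _ , unique = trans (sym (unique (r∈ , c))) (unique (s∈ , d))

    bounded : ∀ o {c i} → Edge Rs o c i → i < n
    bounded horizontal e with find e
    ... | r , r∈ , (_ , i<) , _ = <-≤-trans i< (proj₂ (proj₁ (in-square r∈)))
    bounded vertical e with find e
    ... | r , r∈ , (_ , i<) , _ = <-≤-trans i< (proj₂ (proj₂ (in-square r∈)))

    no-inner-vertical : ∀ {r x j} → r ∈ Rs → left r ≤ x → suc x < right r → bottom r ≤ j → j < top r →
                        ¬ Edge Rs vertical (suc x) j
    no-inner-vertical {r} {x} r∈ l≤x x+1<r b≤j j<t e with find e
    ... | s , s∈ , rows , inj₁ x+1≡l
      with refl ← same-cell r∈ s∈ ((m≤n⇒m≤1+n l≤x , x+1<r) , (b≤j , j<t))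
                    ((≤-reflexive (sym x+1≡l) , subst (_< right s) (sym x+1≡l) (proj₁ (proj₁ (in-square s∈)))) , rows)
      = <⇒≱ (n<1+n x) (subst (_≤ x) (sym x+1≡l) l≤x)
    ... | s , s∈ , rows , inj₂ x+1≡r
      with refl ← same-cell r∈ s∈ ((l≤x , <-trans (n<1+n x) x+1<r) , (b≤j , j<t))
                    ((s≤s⁻¹ (subst (left s <_) (sym x+1≡r) (proj₁ (proj₁ (in-square s∈)))) , ≤-reflexive x+1≡r) , rows)
      = <-irrefl x+1≡r x+1<r

    no-inner-horizontal : ∀ {r i y} → r ∈ Rs → left r ≤ i → i < right r → bottom r ≤ y → suc y < top r →
                          ¬ Edge Rs horizontal (suc y) i
    no-inner-horizontal {r} {_} {y} r∈ l≤i i<r b≤y y+1<t e with find e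
    ... | s , s∈ , cols , inj₁ y+1≡b
      with refl ← same-cell r∈ s∈ ((l≤i , i<r) , (m≤n⇒m≤1+n b≤y , y+1<t))
                    (cols , (≤-reflexive (sym y+1≡b) , subst (_< top s) (sym y+1≡b) (proj₁ (proj₂ (in-square s∈)))))
      = <⇒≱ (n<1+n y) (subst (_≤ y) (sym y+1≡b) b≤y)
    ... | s , s∈ , cols , inj₂ y+1≡t
      with refl ← same-cell r∈ s∈ ((l≤i , i<r) , (b≤y , <-trans (n<1+n y) y+1<t))
                    (cols , (s≤s⁻¹ (subst (bottom s <_) (sym y+1≡t) (proj₁ (proj₂ (in-square s∈)))) , ≤-reflexive y+1≡t))
      = <-irrefl y+1≡t y+1<t

    -- The wall may end at the diagonal point, so a unit edge is guaranteed on one side of it only.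
    incident-edge : ∀ {a b q} → a < b → a ≤ suc q → suc q ≤ b → ∃[ m ] (a ≤ m × m < b) × (q ≤ m × m ≤ suc q)
    incident-edge {a} {b} {q} a<b a≤q+1 q+1≤b with m≤n⇒m<n∨m≡n q+1≤b
    ... | inj₁ q+1<b = suc q , (a≤q+1 , q+1<b) , (n≤1+n q , ≤-refl)
    ... | inj₂ refl  = q , (s≤s⁻¹ a<b , ≤-refl) , (≤-refl , n≤1+n q)

  -- Otherwise the diagonal point between the two cells is interior to `r`, and a unit edge of the
  -- wall through it cuts the interior of `r`.
  diagonal-cells-separated : ∀ {w r} → suc w < n → r ∈ Rs → CellIn w (n ∸ suc w) r →
                             ¬ CellIn (suc w) (n ∸ suc (suc w)) r
  diagonal-cells-separated {w} {r} w+1<n r∈ ((l≤w , _) , (_ , y<t)) ((_ , w+1<r) , (b≤y , _))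
    with pointOnWall (suc w , n ∸ suc w) (suc w , s≤s z≤n , w+1<n , refl)
  ... | s , ((maximal , _) , p∈s) , _ with segmentView s
  ...   | along vertical x a b with p∈s
  ...     | refl , a≤p , p≤b =
    let open MaximalRun (maximal⇒run vertical maximal)
        p≡ = sym (suc-∸-suc w+1<n)
        m , (a≤m , m<b) , (q≤m , m≤q+1) = incident-edge nonempty (subst (a ≤_) p≡ a≤p) (subst (_≤ b) p≡ p≤b)
    in no-inner-vertical r∈ l≤w w+1<r (≤-trans b≤y q≤m) (≤-<-trans m≤q+1 (subst (_< top r) p≡ y<t)) (inside a≤m m<b)
  diagonal-cells-separated {w} {r} w+1<n r∈ ((l≤w , _) , (_ , y<t)) ((_ , w+1<r) , (b≤y , _))
      | s , ((maximal , _) , p∈s) , _ | along horizontal y a b with p∈s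
  ...     | refl , a≤p , p≤b =
    let open MaximalRun (maximal⇒run horizontal maximal)
        p≡ = sym (suc-∸-suc w+1<n)
        m , (a≤m , m<b) , (w≤m , m≤w+1) = incident-edge nonempty a≤p p≤b
    in no-inner-horizontal r∈ (≤-trans l≤w w≤m) (≤-<-trans m≤w+1 w+1<r) b≤y (subst (_< top r) p≡ y<t)
         (subst (λ c → Edge Rs horizontal c m) p≡ (inside a≤m m<b))

  private
    vertical-wall-range : ∀ {x a b} → IsWall n Rs (vseg x a b) → a ≤ n ∸ x × n ∸ x ≤ b
    vertical-wall-range w with wallHasPoint _ w
    ... | _ , (_ , _ , _ , refl) , (refl , range) = range

    horizontal-wall-range : ∀ {y a b} → IsWall n Rs (hseg y a b) → a ≤ n ∸ y × n ∸ y ≤ b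
    horizontal-wall-range w with wallHasPoint _ w
    ... | _ , (i , _ , i<n , refl) , (refl , a≤i , i≤b) =
      subst (_ ≤_) (sym (m∸[m∸n]≡n (<⇒≤ i<n))) a≤i , subst (_≤ _) (sym (m∸[m∸n]≡n (<⇒≤ i<n))) i≤b

    -- Each wall contains a point of X, and the only one on either line is (x , n ∸ x). It would lie
    -- on two walls.
    no-corner-on-diagonal : ∀ {x a b c d} → 0 < x → x < n →
      IsWall n Rs (vseg x a b) → ¬ IsWall n Rs (hseg (n ∸ x) c d)
    no-corner-on-diagonal {x} {a} {b} {c} {d} 0<x x<n v h with pointOnWall (x , n ∸ x) (x , 0<x , x<n , refl)
    ... | s , _ , unique = case trans (sym (unique (v , refl , vertical-wall-range v)))
                                      (unique (h , refl , subst (c ≤_) x≡ (proj₁ r) , subst (_≤ d) x≡ (proj₂ r))) of λ ()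
      where
      r = horizontal-wall-range h
      x≡ = m∸[m∸n]≡n (<⇒≤ x<n)

  -- If the upper right corner of a rectangle is below the diagonal, then both
  -- walls through it extend beyond the corner in order to reach the diagonal.
  top-right-above-diagonal : ∀ {r} → r ∈ Rs → n ∸ top r < right r
  top-right-above-diagonal {rect l b zero t} r∈ = contradiction (proj₁ (proj₁ (in-square r∈))) λ ()
  top-right-above-diagonal {rect l b (suc x) zero} r∈ = contradiction (proj₁ (proj₂ (in-square r∈))) λ ()
  top-right-above-diagonal {rect l b (suc x) (suc y)} r∈ = ≰⇒> λ x<n∸y →
    let (l<r , r≤n) , (b<t , t≤n) = in-square r∈
        x<n = ≤-<-trans x<n∸y (∸-suc-< t≤n)
        y<n∸x = ∸-flip-≤ t≤n x<n∸y
        y<n = ≤-<-trans y<n∸x (∸-suc-< r≤n)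
        a , a′ , (a≤y , y<a′) , v = edge⇒wall vertical (bounded vertical) z<s x<n
                                      (lose r∈ ((s≤s⁻¹ b<t , ≤-refl) , inj₂ refl))
        c , c′ , (c≤x , x<c′) , h = edge⇒wall horizontal (bounded horizontal) z<s y<n
                                      (lose r∈ ((s≤s⁻¹ l<r , ≤-refl) , inj₂ refl))
    in case m≤n⇒m<n∨m≡n y<n∸x of λ where
         (inj₂ y≡) → no-corner-on-diagonal z<s x<n v (subst (λ y → IsWall n Rs (hseg y c c′)) y≡ h)
         (inj₁ y<) → noCrossing _ _ v h (λ ()) ((suc x , suc y) ,
           (refl , s≤s a≤y , <-≤-trans y< (proj₂ (vertical-wall-range v))) ,
           (refl , s≤s c≤x , <-≤-trans (≤∧≢⇒< x<n∸y λ x≡ → <⇒≢ y< (trans (sym (m∸[m∸n]≡n t≤n)) (cong (n ∸_) (sym x≡))))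
                                       (proj₂ (horizontal-wall-range h))))

  bottom-left-below-diagonal : ∀ {r} → r ∈ Rs → left r < n ∸ bottom r
  bottom-left-below-diagonal {rect x y r t} r∈ = ≰⇒> λ n∸y≤x →
    let (l<r , r≤n) , (b<t , t≤n) = in-square r∈
        x<n = <-≤-trans l<r r≤n
        y<n = <-≤-trans b<t t≤n
        0<x = <-≤-trans (m<n⇒0<n∸m y<n) n∸y≤x
        n∸x≤y = ∸-flip-≥ (<⇒≤ y<n) n∸y≤x
        0<y = <-≤-trans (m<n⇒0<n∸m x<n) n∸x≤y
        a , a′ , (a≤y , y<a′) , v = edge⇒wall vertical (bounded vertical) 0<x x<n
                                      (lose r∈ ((≤-refl , b<t) , inj₁ refl))
        c , c′ , (c≤x , x<c′) , h = edge⇒wall horizontal (bounded horizontal) 0<y y<n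
                                      (lose r∈ ((≤-refl , l<r) , inj₁ refl))
    in case m≤n⇒m<n∨m≡n n∸x≤y of λ where
         (inj₂ ≡y) → no-corner-on-diagonal 0<x x<n v (subst (λ y → IsWall n Rs (hseg y c c′)) (sym ≡y) h)
         (inj₁ <y) → noCrossing _ _ v h (λ ()) ((x , y) ,
           (refl , ≤-<-trans (proj₁ (vertical-wall-range v)) <y , y<a′) ,
           (refl , ≤-<-trans (proj₁ (horizontal-wall-range h))
                     (≤∧≢⇒< n∸y≤x λ ≡x → <⇒≢ <y (trans (cong (n ∸_) (sym ≡x)) (m∸[m∸n]≡n (<⇒≤ y<n)))) , x<c′))

  private
    RowsOf : Rect → ℕ → Set
    RowsOf r j = n ∸ top r ≤ j × j < n ∸ bottom r

    cell⇒row : ∀ {r i j} → j < n → CellIn i (n ∸ suc j) r → RowsOf r j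
    cell⇒row {r} {i} {j} j<n (_ , (b≤y , y<t)) = subst (RowsOf r) (∸-suc-∸-suc j<n)
      (∸-monoʳ-≤ n y<t , ∸-monoʳ-< (s≤s b≤y) (∸-suc-< j<n))

    row⇒cell : ∀ {r i j} → r ∈ Rs → left r ≤ i × i < right r → RowsOf r j → CellIn i (n ∸ suc j) r
    row⇒cell {r} {i} {j} r∈ cols (t≤j , j<b) = cols ,
      ∸-flip-≤ (<⇒≤ (<-≤-trans (proj₁ (proj₂ (in-square r∈))) (proj₂ (proj₂ (in-square r∈))))) j<b ,
      subst (_≤ top r) (sym (suc-∸-suc j<n)) (∸-flip-≥ (proj₂ (proj₂ (in-square r∈))) t≤j)
      where j<n = <-≤-trans j<b (m∸n≤m n (bottom r))

    -- The larger of the first column and the first row of `r` is the first diagonal cell that can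
    -- lie in `r`. It does, because the corner lemmas bound it by the opposite side.
    meets-diagonal : ∀ {r} → r ∈ Rs → ∃[ k ] k < n × CellIn k (n ∸ suc k) r
    meets-diagonal {r} r∈ with in-square r∈ | ≤-total (left r) (n ∸ top r)
    ... | (l<r , r≤n) , (b<t , t≤n) | inj₁ l≤t =
      n ∸ top r , <-≤-trans (top-right-above-diagonal r∈) r≤n ,
      row⇒cell r∈ (l≤t , top-right-above-diagonal r∈) (≤-refl , ∸-monoʳ-< b<t t≤n)
    ... | (l<r , r≤n) , (b<t , t≤n) | inj₂ t≤l =
      left r , <-≤-trans l<r r≤n , row⇒cell r∈ (≤-refl , l<r) (t≤l , bottom-left-below-diagonal r∈)

    chosen = choose {n} {P = λ k r → r ∈ Rs × CellIn k (n ∸ suc k) r} (rect 0 0 0 0) λ k k<n →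
      map₂ proj₁ (proj₂ subdivision k (n ∸ suc k) k<n (∸-suc-< k<n))
    f = proj₁ chosen

    f∈ : ∀ {k} → k < n → f k ∈ Rs
    f∈ k<n = proj₁ (proj₂ chosen k<n)

    diagonal-cols : ∀ {k} → k < n → left (f k) ≤ k × k < right (f k)
    diagonal-cols k<n = proj₁ (proj₂ (proj₂ chosen k<n))

    diagonal-rows : ∀ {k} → k < n → RowsOf (f k) k
    diagonal-rows k<n = cell⇒row k<n (proj₂ (proj₂ chosen k<n))

    -- By convexity a rectangle with the diagonal cells k and m would contain the consecutive cells
    -- k and k + 1.
    f-separated : ∀ {k m} → m < n → k < m → f k ≢ f m
    f-separated {k} {m} m<n k<m eq = diagonal-cells-separated k+1<n (f∈ k<n)
      (row⇒cell (f∈ k<n) (diagonal-cols k<n) (diagonal-rows k<n))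
      (row⇒cell (f∈ k<n)
        (m≤n⇒m≤1+n (proj₁ (diagonal-cols k<n)) ,
         ≤-<-trans k<m (subst (λ r → m < right r) (sym eq) (proj₂ (diagonal-cols m<n))))
        (m≤n⇒m≤1+n (proj₁ (diagonal-rows k<n)) ,
         ≤-<-trans k<m (subst (λ r → m < n ∸ bottom r) (sym eq) (proj₂ (diagonal-rows m<n)))))
      where
      k<n = <-trans k<m m<n
      k+1<n = ≤-<-trans k<m m<n

  diagonalRectangulation⇒tiling : Tiling n
  diagonalRectangulation⇒tiling = record
    { L = left ∘ f ; R = right ∘ f ; T = λ k → n ∸ top (f k) ; B = λ k → n ∸ bottom (f k)
    ; L≤ = λ k<n → proj₁ (diagonal-cols k<n)
    ; <R = λ k<n → proj₂ (diagonal-cols k<n)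
    ; R≤ = λ k<n → proj₂ (proj₁ (in-square (f∈ k<n)))
    ; T≤ = λ k<n → proj₁ (diagonal-rows k<n)
    ; <B = λ k<n → proj₂ (diagonal-rows k<n)
    ; B≤ = λ {k} _ → m∸n≤m n (bottom (f k))
    ; cover = cover
    ; disjoint = disjoint
    }
    where
    cover : ∀ {i j} → i < n → j < n → ∃[ k ] k < n × (left (f k) ≤ i × i < right (f k)) × RowsOf (f k) j
    cover {i} {j} i<n j<n with proj₂ subdivision i (n ∸ suc j) i<n (∸-suc-< j<n)
    ... | r , (r∈ , c) , _ with meets-diagonal r∈
    ...   | k , k<n , d with refl ← same-cell r∈ (f∈ k<n) d (proj₂ (proj₂ chosen k<n)) =
      k , k<n , proj₁ c , cell⇒row j<n c

    disjoint : ∀ {k m i j} → k < n → m < n → (left (f k) ≤ i × i < right (f k)) × RowsOf (f k) j →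
               (left (f m) ≤ i × i < right (f m)) × RowsOf (f m) j → k ≡ m
    disjoint {k} {m} k<n m<n (cols , rows) (cols′ , rows′) with <-cmp k m
    ... | tri< k<m _ _ = contradiction (same-cell (f∈ k<n) (f∈ m<n) (row⇒cell (f∈ k<n) cols rows)
                                          (row⇒cell (f∈ m<n) cols′ rows′)) (f-separated m<n k<m)
    ... | tri≈ _ k≡m _ = k≡m
    ... | tri> _ _ m<k = contradiction (same-cell (f∈ m<n) (f∈ k<n) (row⇒cell (f∈ m<n) cols′ rows′)
                                          (row⇒cell (f∈ k<n) cols rows)) (f-separated k<n m<k)

  diagonalRectangulation-represented : Represents diagonalRectangulation⇒tiling Rs
  diagonalRectangulation-represented = record
    { box∈ = λ k<n → subst (_∈ Rs) (f≡box k<n) (f∈ k<n)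
    ; ∈box = λ r∈ → let k , k<n , c = meets-diagonal r∈
                    in k , k<n , trans (same-cell r∈ (f∈ k<n) c (proj₂ (proj₂ chosen k<n))) (f≡box k<n)
    }
    where
    f≡box : ∀ {k} → k < n → f k ≡ Tiling.box diagonalRectangulation⇒tiling k
    f≡box {k} k<n with in-square (f∈ k<n)
    ... | _ , (b<t , t≤n) = cong₂ (λ b t → rect (left (f k)) b (right (f k)) t)
      (sym (m∸[m∸n]≡n (≤-trans (<⇒≤ b<t) t≤n))) (sym (m∸[m∸n]≡n t≤n))

-- Fibres of ρ

module _ {n} (τ : Tiling n) where
  open Tiling τ

  -- The boundaries of tiles i and j show that tile i has to be drawn before
  -- tile j.
  DrawnBefore : ℕ → ℕ → Set
  DrawnBefore i j = (i < j × (j < B i ⊎ T j ≤ i)) ⊎ (j < i × (L i ≤ j ⊎ i < R j))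

  -- Each of the four combinations puts one of the cells (i , j), (j , j), (i , i), (j , i) into
  -- both tiles.
  DrawnBefore-asym : ∀ {i j} → j < n → i < j → j < B i ⊎ T j ≤ i → ¬ (L j ≤ i ⊎ j < R i)
  DrawnBefore-asym {i} {j} j<n i<j p q = <⇒≢ i<j (common p q)
    where
    i<n = <-trans i<j j<n
    i≤j = <⇒≤ i<j
    common : j < B i ⊎ T j ≤ i → L j ≤ i ⊎ j < R i → i ≡ j
    common (inj₁ j<B) (inj₁ L≤i) = disjoint i<n j<n
      (proj₁ (covers-diagonal i<n) , (≤-trans (T≤ i<n) i≤j , j<B))
      ((L≤i , <-trans i<j (<R j<n)) , proj₂ (covers-diagonal j<n))
    common (inj₁ j<B) (inj₂ j<R) = disjoint i<n j<n
      ((≤-trans (L≤ i<n) i≤j , j<R) , (≤-trans (T≤ i<n) i≤j , j<B)) (covers-diagonal j<n)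
    common (inj₂ T≤i) (inj₁ L≤i) = disjoint i<n j<n (covers-diagonal i<n)
      ((L≤i , <-trans i<j (<R j<n)) , (T≤i , <-trans i<j (<B j<n)))
    common (inj₂ T≤i) (inj₂ j<R) = disjoint i<n j<n
      ((≤-trans (L≤ i<n) i≤j , j<R) , proj₂ (covers-diagonal i<n))
      (proj₁ (covers-diagonal j<n) , (T≤i , <-trans i<j (<B j<n)))

  -- Betweenness holds by convexity: a tile that reaches the row or column of a distant label
  -- reaches those of all labels in between.
  DrawnBefore-isBetweenRelation : IsBetweenRelation {n} (λ i j → DrawnBefore (toℕ i) (toℕ j))
  DrawnBefore-isBetweenRelation = record
    { _≺?_ = λ i j → ((toℕ i <? toℕ j) ×-dec ((toℕ j <? B (toℕ i)) ⊎-dec (T (toℕ j) ≤? toℕ i))) ⊎-dec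
                     ((toℕ j <? toℕ i) ×-dec ((L (toℕ i) ≤? toℕ j) ⊎-dec (toℕ i <? R (toℕ j))))
    ; asym      = asym
    ; between-< = between-<
    ; between-> = between->
    }
    where
    asym : ∀ {i j : Fin n} → DrawnBefore (toℕ i) (toℕ j) → ¬ DrawnBefore (toℕ j) (toℕ i)
    asym {j = j} (inj₁ (i<j , p)) (inj₂ (_ , q)) = DrawnBefore-asym (Fin.toℕ<n j) i<j p q
    asym {i = i} (inj₂ (j<i , q)) (inj₁ (_ , p)) = DrawnBefore-asym (Fin.toℕ<n i) j<i p q
    asym (inj₁ (i<j , _)) (inj₁ (j<i , _)) = <-asym i<j j<i
    asym (inj₂ (j<i , _)) (inj₂ (i<j , _)) = <-asym i<j j<i
    between-< : ∀ {i j k} → i < j → j < k → DrawnBefore i k → DrawnBefore i j ⊎ DrawnBefore j k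
    between-< i<j j<k (inj₁ (_ , inj₁ k<B)) = inj₁ (inj₁ (i<j , inj₁ (<-trans j<k k<B)))
    between-< i<j j<k (inj₁ (_ , inj₂ T≤i)) = inj₂ (inj₁ (j<k , inj₂ (≤-trans T≤i (<⇒≤ i<j))))
    between-< i<j j<k (inj₂ (k<i , _)) = contradiction k<i (<-asym (<-trans i<j j<k))
    between-> : ∀ {i j k} → i < j → j < k → DrawnBefore k i → DrawnBefore k j ⊎ DrawnBefore j i
    between-> i<j j<k (inj₂ (_ , inj₁ L≤i)) = inj₁ (inj₂ (j<k , inj₁ (≤-trans L≤i (<⇒≤ i<j))))
    between-> i<j j<k (inj₂ (_ , inj₂ k<R)) = inj₂ (inj₂ (i<j , inj₂ (<-trans j<k k<R)))
    between-> i<j j<k (inj₁ (k<i , _)) = contradiction k<i (<-asym (<-trans i<j j<k))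

  -- The cell (m , k) just left of tile k belongs to a tile e with m ≤ e ≤ k. If m < e, this tile
  -- would also cover (m + 1 , k) and so be tile k, which ends there. Hence e = m.
  tile-at-left-side : ∀ {k m} → k < n → L k ≡ suc m → k < B m
  tile-at-left-side {k} {m} k<n L≡m+1 with cover m<n k<n
    where
    m<n = <-trans (subst (m <_) (sym L≡m+1) (n<1+n m)) (≤-<-trans (L≤ k<n) k<n)
  ... | e , e<n , c@((L≤m , m<R) , rows) with covers-between (<⇒≤ m<k) k<n e<n c
    where
    m<k : m < k
    m<k = subst (_≤ k) L≡m+1 (L≤ k<n)
  ...   | m≤e , e≤k with m≤n⇒m<n∨m≡n m≤e
  ...     | inj₂ refl = proj₂ rows
  ...     | inj₁ m<e  = contradiction (subst (λ e → L e ≤ m) e≡k L≤m) (<⇒≱ (≤-reflexive (sym L≡m+1)))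
    where
    e≡k : e ≡ k
    e≡k = disjoint e<n k<n ((m≤n⇒m≤1+n L≤m , ≤-<-trans m<e (<R e<n)) , rows)
      ((≤-reflexive L≡m+1 , ≤-<-trans (≤-trans m<e e≤k) (<R k<n)) , proj₂ (covers-diagonal k<n))

  tile-at-right-side : ∀ {k} → k < n → R k < n → T (R k) ≤ k
  tile-at-right-side {k} k<n R<n = at (R k) refl
    where
    at : ∀ m → R k ≡ m → T m ≤ k
    at zero R≡0 = contradiction (subst (k <_) R≡0 (<R k<n)) λ ()
    at (suc m) R≡m+1 with cover m+1<n k<n
      where m+1<n = subst (_< n) R≡m+1 R<n
    ... | e , e<n , c@((L≤m+1 , m+1<R) , rows) with covers-between′ τ (m≤n⇒m≤1+n k≤m) (subst (_< n) R≡m+1 R<n) e<n c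
      where
      k≤m : k ≤ m
      k≤m = s≤s⁻¹ (subst (k <_) R≡m+1 (<R k<n))
    ...   | k≤e , e≤m+1 with m≤n⇒m<n∨m≡n e≤m+1
    ...     | inj₂ refl = proj₁ rows
    ...     | inj₁ e≤m  = contradiction (subst (λ e → suc m < R e) e≡k m+1<R) (<-irrefl (sym R≡m+1))
      where
      e≡k : e ≡ k
      e≡k = disjoint e<n k<n ((≤-trans (L≤ e<n) (s≤s⁻¹ e≤m) , <-trans (n<1+n m) m+1<R) , rows)
        ((≤-trans (L≤ k<n) (≤-trans k≤e (s≤s⁻¹ e≤m)) , ≤-reflexive (sym R≡m+1)) , proj₂ (covers-diagonal k<n))

module _ {n} (τ : Tiling n) {_⊏_ : Rel ℕ 0ℓ} (sto : IsStrictTotalOrder _≡_ _⊏_)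
         (extends : ∀ {i j} → i < n → j < n → DrawnBefore τ i j → i ⊏ j) where
  open Tiling τ
  open IsStrictTotalOrder sto using (asym)

  -- Labels inside a run are ordered against k by a side of tile k. The label at which a run stops
  -- names the tile adjacent to that side in row or column k, which orders the two labels the other
  -- way.
  linearExtension⇒isTile : ∀ {k} → k < n → IsTile _⊏_ n k (L k) (R k) (T k) (B k)
  linearExtension⇒isTile {k} k<n = record
    { isL = record
      { below  = L≤ k<n
      ; inside = λ L≤m m<k → extends k<n (<-trans m<k k<n) (inj₂ (m<k , inj₁ L≤m))
      ; stop   = λ L≡m+1 → let m<k = subst (_≤ k) L≡m+1 (L≤ k<n) in
          asym (extends (<-trans m<k k<n) k<n (inj₁ (m<k , inj₁ (tile-at-left-side τ k<n L≡m+1)))) }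
    ; isR = record
      { above  = <R k<n
      ; bound  = R≤ k<n
      ; inside = λ k<m m<R → extends (<-≤-trans m<R (R≤ k<n)) k<n (inj₂ (k<m , inj₂ m<R))
      ; stop   = λ R<n → asym (extends k<n R<n (inj₁ (<R k<n , inj₂ (tile-at-right-side τ k<n R<n)))) }
    ; isT = record
      { below  = T≤ k<n
      ; inside = λ T≤m m<k → extends (<-trans m<k k<n) k<n (inj₁ (m<k , inj₂ T≤m))
      ; stop   = λ T≡m+1 → let m<k = subst (_≤ k) T≡m+1 (T≤ k<n) in
          asym (extends k<n (<-trans m<k k<n) (inj₂ (m<k , inj₂ (tile-at-left-side (transpose τ) k<n T≡m+1)))) }
    ; isB = record
      { above  = <B k<n
      ; bound  = B≤ k<n
      ; inside = λ k<m m<B → extends k<n (<-≤-trans m<B (B≤ k<n)) (inj₁ (k<m , inj₁ m<B))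
      ; stop   = λ B<n → asym (extends B<n k<n (inj₂ (<B k<n , inj₁ (tile-at-right-side (transpose τ) k<n B<n)))) }
    }

-- Greedy extensions, descents and twisted Baxter permutations

module _ {n} {π : Permutation′ n} (τ : Tiling n)
         (greedy : IsGreedyExtension (λ i j → DrawnBefore τ (toℕ i) (toℕ j)) π) where
  open Tiling τ
  open IsGreedyExtension greedy

  greedy⇒twistedBaxter : IsTwistedBaxter π
  greedy⇒twistedBaxter = no-3412 , no-2413
    where
    -- The two patterns differ only in the order of b and c, which does not matter here: the side
    -- that shows d ≺ a puts all labels between a and d after d, or all of them before a.
    all-after-or-before : ∀ {j k} → toℕ k ≡ suc (toℕ j) → (π ⟨$⟩ʳ k) Fin.< (π ⟨$⟩ʳ j) →
      ∀ {i l} → i Fin.< j → k Fin.< l →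
      (π ⟨$⟩ʳ k) Fin.< (π ⟨$⟩ʳ i) → (π ⟨$⟩ʳ i) Fin.< (π ⟨$⟩ʳ j) →
      (π ⟨$⟩ʳ k) Fin.< (π ⟨$⟩ʳ l) → ¬ (π ⟨$⟩ʳ l) Fin.< (π ⟨$⟩ʳ j)
    all-after-or-before {j} {k} k≡j+1 a<d {i} {l} i<j k<l a<πi πi<d a<πl πl<d with descends j k k≡j+1 a<d
    ... | inj₁ (d<a , _) = <-asym a<d d<a
    ... | inj₂ (_ , inj₁ L≤a) = <-asym i<j (extends j i (inj₂ (πi<d , inj₁ (≤-trans L≤a (<⇒≤ a<πi)))))
    ... | inj₂ (_ , inj₂ d<R) = <-asym k<l (extends l k (inj₂ (a<πl , inj₂ (<-trans πl<d d<R))))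
    no-3412 : ¬ Contains3-41-2 π
    no-3412 (i , j , k , l , i<j , k≡j+1 , k<l , a<b , b<c , c<d) =
      all-after-or-before k≡j+1 (<-trans a<b (<-trans b<c c<d)) i<j k<l (<-trans a<b b<c) c<d a<b (<-trans b<c c<d)
    no-2413 : ¬ Contains2-41-3 π
    no-2413 (i , j , k , l , i<j , k≡j+1 , k<l , a<b , b<c , c<d) =
      all-after-or-before k≡j+1 (<-trans a<b (<-trans b<c c<d)) i<j k<l a<b (<-trans b<c c<d) (<-trans a<b b<c) c<d

module _ {n} (x : Permutation′ n) where

  label : ∀ {m} → m < n → ∃[ i ] m ≡ toℕ (x ⟨$⟩ʳ i)
  label m<n = x ⟨$⟩ˡ fromℕ< m<n , sym (trans (cong toℕ (inverseʳ x)) (Fin.toℕ-fromℕ< m<n))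

  ⇒precedes : ∀ {i j} → i Fin.< j → Precedes (position x) (toℕ (x ⟨$⟩ʳ i)) (toℕ (x ⟨$⟩ʳ j))
  ⇒precedes {i} {j} i<j = subst₂ _<_ (sym (position-at x i)) (sym (position-at x j)) i<j

  precedes⇒ : ∀ {i j} → Precedes (position x) (toℕ (x ⟨$⟩ʳ i)) (toℕ (x ⟨$⟩ʳ j)) → i Fin.< j
  precedes⇒ {i} {j} = subst₂ _<_ (position-at x i) (position-at x j)

  ⟨$⟩ʳ-injective : ∀ {i j} → x ⟨$⟩ʳ i ≡ x ⟨$⟩ʳ j → i ≡ j
  ⟨$⟩ʳ-injective eq = trans (sym (inverseˡ x)) (trans (cong (x ⟨$⟩ˡ_) eq) (inverseˡ x))

  greedy-represents : (τ : Tiling n) → IsGreedyExtension (λ i j → DrawnBefore τ (toℕ i) (toℕ j)) x → Represents τ (ρ x)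
  greedy-represents τ greedy = ρ-represented-by x τ
    (linearExtension⇒isTile τ (Precedes-isStrictTotalOrder (position-injective x)) extends)
    where
    extends : ∀ {a b} → a < n → b < n → DrawnBefore τ a b → Precedes (position x) a b
    extends a<n b<n a≺b with label a<n | label b<n
    ... | i , refl | j , refl = ⇒precedes (IsGreedyExtension.extends greedy i j a≺b)

  module _ {τ : Tiling n} (represents : Represents τ (ρ x)) where
    open Tiling τ
    open Represents represents

    -- The rectangle drawn for k is some `box m`; it contains the diagonal cell k, so m = k.
    represented⇒isTile : ∀ {k} → k < n → IsTile (Precedes (position x)) n k (L k) (R k) (T k) (B k)
    represented⇒isTile {k} k<n with Drawn.tile-of (ρ-drawn x) k<n (position-< x k<n)
    ... | r , r∈ , tileRect with ∈box r∈
    ...   | m , m<n , refl = subst (λ m → IsTile _ n k (L m) (R m) (T m) (B m)) m≡k isTile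
      where
      isTile : IsTile (Precedes (position x)) n k (L m) (R m) (T m) (B m)
      isTile = subst₂ (IsTile _ n k (L m) (R m)) (m∸[m∸n]≡n (≤-trans (T≤ m<n) (<⇒≤ m<n))) (m∸[m∸n]≡n (B≤ m<n))
                 (IsTileRect.isTile tileRect)
      open IsTile isTile
      m≡k : m ≡ k
      m≡k = disjoint m<n k<n ((IsLower.below isL , IsUpper.above isR) , (IsLower.below isT , IsUpper.above isB))
                             (covers-diagonal k<n)

    -- If no label between a and d stands before d, the left run of d reaches a. If one does, any
    -- label between them that stands after a completes a forbidden pattern, and the order of the
    -- two labels decides which; so the right run of a passes d.
    twistedBaxter-descent : IsTwistedBaxter x → ∀ {j k} → toℕ k ≡ suc (toℕ j) → (x ⟨$⟩ʳ k) Fin.< (x ⟨$⟩ʳ j) →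
      L (toℕ (x ⟨$⟩ʳ j)) ≤ toℕ (x ⟨$⟩ʳ k) ⊎ toℕ (x ⟨$⟩ʳ j) < R (toℕ (x ⟨$⟩ʳ k))
    twistedBaxter-descent (no-3412 , no-2413) {j} {k} k≡j+1 a<d
      with Fin.any? (λ i → (i Fin.<? j) ×-dec (((x ⟨$⟩ʳ k) Fin.<? (x ⟨$⟩ʳ i)) ×-dec ((x ⟨$⟩ʳ i) Fin.<? (x ⟨$⟩ʳ j))))
    ... | no none = inj₁ (IsLower.least (IsTile.isL (represented⇒isTile (Fin.toℕ<n (x ⟨$⟩ʳ j)))) (<⇒≤ a<d) after)
      where
      j<k = ≤-reflexive (sym k≡j+1)
      after : ∀ {m} → toℕ (x ⟨$⟩ʳ k) ≤ m → m < toℕ (x ⟨$⟩ʳ j) → Precedes (position x) (toℕ (x ⟨$⟩ʳ j)) m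
      after a≤m m<d with label (<-trans m<d (Fin.toℕ<n _))
      ... | i , refl with m≤n⇒m<n∨m≡n a≤m
      ...   | inj₂ a≡m = subst (Precedes (position x) _) a≡m (⇒precedes j<k)
      ...   | inj₁ a<m = ¬Precedes⇒Precedes (position-injective x)
        (λ m⊏d → none (i , precedes⇒ m⊏d , a<m , m<d)) (<⇒≢ m<d)
    ... | yes (i , i<j , a<πi , πi<d) =
      inj₂ (IsUpper.greater (IsTile.isR (represented⇒isTile (Fin.toℕ<n (x ⟨$⟩ʳ k)))) (Fin.toℕ<n (x ⟨$⟩ʳ j)) before)
      where
      j<k = ≤-reflexive (sym k≡j+1)
      before : ∀ {m} → toℕ (x ⟨$⟩ʳ k) < m → m ≤ toℕ (x ⟨$⟩ʳ j) → Precedes (position x) m (toℕ (x ⟨$⟩ʳ k))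
      before a<m m≤d with label (≤-<-trans m≤d (Fin.toℕ<n _))
      ... | l , refl with m≤n⇒m<n∨m≡n m≤d
      ...   | inj₂ m≡d = subst (λ m → Precedes (position x) m _) (sym m≡d) (⇒precedes j<k)
      ...   | inj₁ m<d = ¬Precedes⇒Precedes (position-injective x)
        (λ a⊏m → let k<l = precedes⇒ a⊏m in case Fin.<-cmp (x ⟨$⟩ʳ i) (x ⟨$⟩ʳ l) of λ where
          (tri< b<c _ _) → no-2413 (i , j , k , l , i<j , k≡j+1 , k<l , a<πi , b<c , m<d)
          (tri≈ _ eq _)  → <⇒≢ (<-trans i<j (<-trans j<k k<l)) (cong toℕ (⟨$⟩ʳ-injective eq))
          (tri> _ _ b<c) → no-3412 (i , j , k , l , i<j , k≡j+1 , k<l , a<m , b<c , πi<d))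
        (<⇒≢ a<m)

-- Uniqueness of the twisted Baxter permutation in a fibre

crossing-down : ∀ {n} {Q : Fin n → Set} → Decidable Q → ∀ {i} p → i Fin.< p → Q i → ¬ Q p →
                ∃[ j ] ∃[ k ] toℕ k ≡ suc (toℕ j) × (i Fin.≤ j × k Fin.≤ p) × Q j × ¬ Q k
crossing-down {n} {Q} Q? {i} p = search p (Fin.<-wellFounded p)
  where
  search : ∀ p → Acc Fin._<_ p → i Fin.< p → Q i → ¬ Q p →
           ∃[ j ] ∃[ k ] toℕ k ≡ suc (toℕ j) × (i Fin.≤ j × k Fin.≤ p) × Q j × ¬ Q k
  search (Fin.suc p) (acc smaller) (s≤s i≤p) qi ¬qp with Q? (Fin.inject₁ p)
  ... | yes q = Fin.inject₁ p , Fin.suc p , cong suc (sym (Fin.toℕ-inject₁ p)) ,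
                (subst (toℕ i ≤_) (sym (Fin.toℕ-inject₁ p)) i≤p , ≤-refl) , q , ¬qp
  ... | no ¬q with m≤n⇒m<n∨m≡n i≤p
  ...   | inj₂ i≡p = contradiction (subst Q (Fin.toℕ-injective (trans i≡p (sym (Fin.toℕ-inject₁ p)))) qi) ¬q
  ...   | inj₁ i<p with search (Fin.inject₁ p) (smaller (≤-reflexive (cong suc (Fin.toℕ-inject₁ p))))
                          (subst (toℕ i <_) (sym (Fin.toℕ-inject₁ p)) i<p) qi ¬q
  ...     | j , k , k≡j+1 , (i≤j , k≤p) , q = j , k , k≡j+1 ,
    (i≤j , m≤n⇒m≤1+n (subst (toℕ k ≤_) (Fin.toℕ-inject₁ p) k≤p)) , q

module _ {n} {τ : Tiling n} (x y : Permutation′ n) (x-represents : Represents τ (ρ x)) (y-represents : Represents τ (ρ y)) where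
  open Tiling τ

  -- A twisted Baxter permutation is lexicographically minimal in its fibre
  -- under ρ.  If x and y first differ at i with y i < x i, then x has a
  -- descent j, j + 1 past the value y i, between i and the position of y i.
  twistedBaxter-minimal : IsTwistedBaxter x → ∀ i → (∀ {j} → j Fin.< i → x ⟨$⟩ʳ j ≡ y ⟨$⟩ʳ j) →
                          ¬ (y ⟨$⟩ʳ i) Fin.< (x ⟨$⟩ʳ i)
  twistedBaxter-minimal baxter i agree e<xi
    with crossing-down (λ j → (y ⟨$⟩ʳ i) Fin.<? (x ⟨$⟩ʳ j)) p i<p e<xi (λ e<xp → <-irrefl (cong toℕ (sym xp≡e)) e<xp)
    where
    p = x ⟨$⟩ˡ (y ⟨$⟩ʳ i)
    xp≡e : x ⟨$⟩ʳ p ≡ y ⟨$⟩ʳ i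
    xp≡e = inverseʳ x
    i<p : i Fin.< p
    i<p with Fin.<-cmp i p
    ... | tri< i<p _ _ = i<p
    ... | tri≈ _ i≡p _ = contradiction (cong toℕ (trans (sym xp≡e) (cong (x ⟨$⟩ʳ_) (sym i≡p)))) (<⇒≢ e<xi)
    ... | tri> _ _ p<i = contradiction (cong toℕ (⟨$⟩ʳ-injective y (trans (sym (agree p<i)) xp≡e))) (<⇒≢ p<i)
  ... | j , k , k≡j+1 , (i≤j , k≤p) , e<f , e≮g = result (twistedBaxter-descent x x-represents baxter k≡j+1 g<f)
    where
    p = x ⟨$⟩ˡ (y ⟨$⟩ʳ i)
    e = toℕ (y ⟨$⟩ʳ i)
    f = toℕ (x ⟨$⟩ʳ j)
    g = toℕ (x ⟨$⟩ʳ k)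
    f<n = Fin.toℕ<n (x ⟨$⟩ʳ j)
    g<n = Fin.toℕ<n (x ⟨$⟩ʳ k)
    g≤e : g ≤ e
    g≤e = ≮⇒≥ e≮g
    g<f : g < f
    g<f = ≤-<-trans g≤e e<f

    -- In `y` the label e stands at i, and the entries before it stand at the same places in `x`,
    -- whereas f stands in `x` at j ≥ i.
    not-before : ¬ Precedes (position y) f e
    not-before f⊏e with label y f<n
    ... | h , f≡yh = <⇒≱ h<i (subst (toℕ i ≤_) (sym (cong toℕ h≡j)) i≤j)
      where
      h<i : h Fin.< i
      h<i = precedes⇒ y (subst (λ f → Precedes (position y) f e) f≡yh f⊏e)
      h≡j : h ≡ j
      h≡j = ⟨$⟩ʳ-injective x (trans (agree h<i) (Fin.toℕ-injective (sym f≡yh)))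

    -- Since g ≤ e < f, the tile side that shows f ≺ g also concerns e. It puts f before e, which
    -- fails in `y`, or e before g, which fails in `x` because k ≤ p. The tiling is common to both,
    -- so each can be read in the permutation where it fails.
    result : ¬ (L f ≤ g ⊎ f < R g)
    result (inj₁ L≤g) = not-before (IsLower.inside (IsTile.isL (represented⇒isTile y y-represents f<n)) (≤-trans L≤g g≤e) e<f)
    result (inj₂ f<R) with m≤n⇒m<n∨m≡n g≤e
    ... | inj₂ g≡e = not-before (subst (Precedes (position y) f) g≡e
            (IsUpper.inside (IsTile.isR (represented⇒isTile y y-represents g<n)) g<f f<R))
    ... | inj₁ g<e = <⇒≱ (precedes⇒ x (subst (λ e → Precedes (position x) e g) (cong toℕ (sym (inverseʳ x)))
            (IsUpper.inside (IsTile.isR (represented⇒isTile x x-represents g<n)) g<e (<-trans e<f f<R)))) k≤p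

fibre-unique : ∀ {n} {τ : Tiling n} (x y : Permutation′ n) → Represents τ (ρ x) → Represents τ (ρ y) →
               IsTwistedBaxter x → IsTwistedBaxter y → x Perm.≈ y
fibre-unique {τ = τ} x y x-represents y-represents x-baxter y-baxter i = agree i (Fin.<-wellFounded i)
  where
  agree : ∀ i → Acc Fin._<_ i → x ⟨$⟩ʳ i ≡ y ⟨$⟩ʳ i
  agree i (acc smaller) with Fin.<-cmp (x ⟨$⟩ʳ i) (y ⟨$⟩ʳ i)
  ... | tri< x<y _ _ = contradiction x<y (twistedBaxter-minimal y x y-represents x-represents y-baxter i
                         λ {j} j<i → sym (agree j (smaller j<i)))
  ... | tri≈ _ x≡y _ = x≡y
  ... | tri> _ _ y<x = contradiction y<x (twistedBaxter-minimal x y x-represents y-represents x-baxter i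
                         λ {j} j<i → agree j (smaller j<i))

-- The bijection

Represents-resp-∼ : ∀ {n} {τ : Tiling n} {Rs Ss} → Rs ∼[ set ] Ss → Represents τ Rs → Represents τ Ss
Represents-resp-∼ Rs∼Ss represents = record
  { box∈ = λ k<n → Equivalence.to Rs∼Ss (box∈ k<n) ; ∈box = λ r∈Ss → ∈box (Equivalence.from Rs∼Ss r∈Ss) }
  where open Represents represents

Represents⇒∼ : ∀ {n} {τ : Tiling n} {Rs Ss} → Represents τ Rs → Represents τ Ss → Rs ∼[ set ] Ss
Represents⇒∼ r s = mk⇔ (include r s) (include s r)
  where
  include : ∀ {n} {τ : Tiling n} {Rs Ss q} → Represents τ Rs → Represents τ Ss → q ∈ Rs → q ∈ Ss
  include r s q∈Rs with Represents.∈box r q∈Rs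
  ... | k , k<n , refl = Represents.box∈ s k<n

ρ-cong : ∀ {n} {x y : Permutation′ n} → x Perm.≈ y → ρ x ≡ ρ y
ρ-cong {n} x≈y = cong (foldl (draw n) []) (tabulate-cong x≈y)

ρ-represents : ∀ {n} (x : Permutation′ n) → ∃[ τ ] Represents {n} τ (ρ x)
ρ-represents x with ρ-tiling x
... | τ , isTile = τ , ρ-represented-by x τ isTile

ρ-isDiagonalRectangulation : ∀ {n} (x : Permutation′ n) → IsDiagonalRectangulation n (ρ x)
ρ-isDiagonalRectangulation x = represents⇒isDiagonalRectangulation (proj₂ (ρ-represents x))

ρ-injective : ∀ {n} {x y : TwistedBaxter n} → ρ (proj₁ x) ∼[ set ] ρ (proj₁ y) → x ≈ᵀ y
ρ-injective {x = x , x-baxter} {y , y-baxter} ρx∼ρy with ρ-represents x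
... | τ , represents = fibre-unique x y represents (Represents-resp-∼ ρx∼ρy represents) x-baxter y-baxter

ρ-surjective : ∀ {n} (D : dRec n) → Σ[ x ∈ TwistedBaxter n ] ρ (proj₁ x) ∼[ set ] proj₁ D
ρ-surjective (Rs , isDR) with greedyExtension (DrawnBefore-isBetweenRelation (diagonalRectangulation⇒tiling isDR))
... | π , greedy = (π , greedy⇒twistedBaxter τ greedy) ,
    Represents⇒∼ (greedy-represents π τ greedy) (diagonalRectangulation-represented isDR)
  where τ = diagonalRectangulation⇒tiling isDR

theorem6p1 : ∀ (n : ℕ) → 1 ≤ n →
    Σ[ ρ-dRec ∈ (∀ (x : Permutation′ n) → IsDiagonalRectangulation n (ρ x)) ]
    IsBijection (_≈ᵀ_ {n}) (_≈ᴰ_ {n}) (λ (x , _) → ρ x , ρ-dRec x)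
theorem6p1 n _ = ρ-isDiagonalRectangulation , record
  { isInjection = record
    { isCongruent = record
      { cong = λ {x} {y} x≈y → ≡⇒∼ (ρ-cong {x = proj₁ x} {proj₁ y} x≈y)
      ; isEquivalence₁ = record
        { refl = λ _ → refl ; sym = λ x≈y i → sym (x≈y i) ; trans = λ x≈y y≈z i → trans (x≈y i) (y≈z i) }
      ; isEquivalence₂ = record { refl = Set.refl ; sym = Set.sym ; trans = Set.trans }
      }
    ; injective = λ {x} {y} → ρ-injective {x = x} {y}
    }
  ; surjective = λ D → let x , ρx∼D = ρ-surjective D in
      x , λ {z} z≈x → Set.trans (≡⇒∼ (ρ-cong {x = proj₁ z} {proj₁ x} z≈x)) ρx∼D
  }
  where
  module Set = Setoid ([ set ]-Equality Rect)
  ≡⇒∼ : ∀ {Rs Ss : List Rect} → Rs ≡ Ss → Rs ∼[ set ] Ss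
  ≡⇒∼ refl = Set.refl
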